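{- There is an absolute constant $C>0$ such that the following holds. Let $p$ be a prime, let $g$ be a primitive root modulo $p$, let $N$ be an integer with $1\le N<p$, and let $h$ be an integer with $h\not\equiv 0\pmod p$. Let $J_1$ denote the number of pairs of integers $(x,y)$ satisfying $$g^x-g^y\equiv h\pmod p,\qquad 1\le x,y\le N.$$ Then $$\left|J_1-\frac{N^2}{p}\right|\le C\left(\frac{N}{p^{1/4}}+p^{1/2}\right).$$ -}

module Defs where

open import Data.Integer as ℤ using (ℤ)
import Data.Integer.Divisibility.Signed as ℤ
import Data.Integer.Properties as ℤ
open import Data.Integer.Coprimality using (Coprime)
open import Data.List using (List; map; upTo; filter; length; cartesianProduct)
open import Data.Nat as ℕ using (ℕ; zero; suc)
import Data.Nat.Coprimality as ℕ
import Data.Nat.Properties as ℕ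
open import Data.Product using (∃; ∃-syntax; _×_; _,_; proj₁; proj₂)
open import Data.Rational
  using ( ℚ; mkℚ; 0ℚ; 1ℚ; ½; positive; nonNegative; NonNegative; >-nonZero
        ; _+_; _*_; _-_; -_; 1/_; _/_; _⊓_; ∣_∣; _<_; *<*; _≤_)
import Data.Rational.Properties as ℚ
open import Data.Rational.Solver using (module +-*-Solver)
open import Algebra.Definitions.RawSemiring ℚ.+-*-rawSemiring using (_^_)
open import Data.Sum using (_⊎_; inj₁; inj₂)
open import Data.Empty using (⊥-elim)
open import Function using (case_of_)
open import Relation.Nullary using (¬_; yes; no)
open import Relation.Unary using (Decidable)
open import Relation.Binary.PropositionalEquality
  using (_≡_; refl; sym; trans; cong; subst; subst₂)

open ℚ.≤-Reasoning

private variable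
  a b c d q r : ℚ

infix 4 _≡_[mod_]

_≡_[mod_] : ℤ → ℤ → ℕ → Set
a ≡ b [mod n ] = ℤ.+ n ℤ.∣ a ℤ.- b

PrimitiveRoot : ℤ → ℕ → Set
PrimitiveRoot g n =
  Coprime g (ℤ.+ n) ×
  (∀ (a : ℤ) → Coprime a (ℤ.+ n) → ∃[ k ] (g ℤ.^ k) ≡ a [mod n ])

IsSolution : (p : ℕ) (g h : ℤ) → ℕ × ℕ → Set
IsSolution p g h (x , y) = (g ℤ.^ x ℤ.- g ℤ.^ y) ≡ h [mod p ]

isSolution? : ∀ p g h → Decidable (IsSolution p g h)
isSolution? p g h (x , y) = ℤ.+ p ℤ.∣? (g ℤ.^ x ℤ.- g ℤ.^ y) ℤ.- h

[1⋯_] : ℕ → List ℕ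
[1⋯ N ] = map suc (upTo N)

-- Every x, y in 1, …, N is positive, so natural exponents suffice.

J₁ : (p : ℕ) (g : ℤ) (N : ℕ) (h : ℤ) → ℕ
J₁ p g N h =
  length (filter (isSolution? p g h) (cartesianProduct [1⋯ N ] [1⋯ N ]))

private
  *ˡ-< : 0ℚ < c → a < b → c * a < c * b
  *ˡ-< {c} 0<c = ℚ.*-monoʳ-<-pos c {{positive 0<c}}

  *ʳ-< : 0ℚ < c → a < b → a * c < b * c
  *ʳ-< {c} 0<c = ℚ.*-monoˡ-<-pos c {{positive 0<c}}

  *ˡ-≤ : 0ℚ ≤ c → a ≤ b → c * a ≤ c * b
  *ˡ-≤ {c} 0≤c = ℚ.*-monoˡ-≤-nonNeg c {{nonNegative 0≤c}}

  *ʳ-≤ : 0ℚ ≤ c → a ≤ b → a * c ≤ b * c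
  *ʳ-≤ {c} 0≤c = ℚ.*-monoʳ-≤-nonNeg c {{nonNegative 0≤c}}

  *-pos : 0ℚ < a → 0ℚ < b → 0ℚ < a * b
  *-pos {a} {b} 0<a 0<b = subst (_< a * b) (ℚ.*-zeroʳ a) (*ˡ-< 0<a 0<b)

  +-pos : 0ℚ < a → 0ℚ < b → 0ℚ < a + b
  +-pos {a} {b} 0<a 0<b = subst (_< a + b) (ℚ.+-identityʳ 0ℚ) (ℚ.+-mono-< 0<a 0<b)

  0<1 : 0ℚ < 1ℚ
  0<1 = ℚ.positive⁻¹ 1ℚ

  0<½ : 0ℚ < ½
  0<½ = ℚ.positive⁻¹ ½

  ½<1 : ½ < 1ℚ
  ½<1 = *<* (ℤ.+<+ (ℕ.s≤s (ℕ.s≤s ℕ.z≤n)))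

  a<b⇒0<b-a : a < b → 0ℚ < b - a
  a<b⇒0<b-a {a} {b} a<b = subst (_< b - a) (ℚ.+-inverseʳ a) (ℚ.+-monoˡ-< (- a) a<b)

  a≤c+b⇒a-c≤b : ∀ a b c → a ≤ c + b → a - c ≤ b
  a≤c+b⇒a-c≤b a b c le = subst (a - c ≤_) (eq b c) (ℚ.+-monoˡ-≤ (- c) le)
    where
    open +-*-Solver
    eq : ∀ b c → c + b - c ≡ b
    eq = solve 2 (λ b c → c :+ b :- c := b) refl

  a-c≤b⇒a≤b+c : ∀ a b c → a - c ≤ b → a ≤ b + c
  a-c≤b⇒a≤b+c a b c le = subst (_≤ b + c) (eq a c) (ℚ.+-monoˡ-≤ c le)
    where
    open +-*-Solver
    eq : ∀ a c → a - c + c ≡ a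
    eq = solve 2 (λ a c → a :- c :+ c := a) refl

  module Reciprocal {q : ℚ} (0<q : 0ℚ < q) where
    private instance
      _ = positive 0<q
      _ = >-nonZero 0<q

    recip : ℚ
    recip = 1/ q

    0<recip : 0ℚ < recip
    0<recip = ℚ.positive⁻¹ recip {{ℚ.1/pos⇒pos q}}

    inverseʳ : q * recip ≡ 1ℚ
    inverseʳ = ℚ.*-inverseʳ q

    inverseˡ : recip * q ≡ 1ℚ
    inverseˡ = ℚ.*-inverseˡ q

    cancel : ∀ a → a * recip * q ≡ a
    cancel a = trans (ℚ.*-assoc a recip q) (trans (cong (a *_) inverseˡ) (ℚ.*-identityʳ a))

  open Reciprocal

  ^-pos : ∀ k → 0ℚ < a → 0ℚ < a ^ k
  ^-pos zero    0<a = 0<1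
  ^-pos (suc k) 0<a = *-pos 0<a (^-pos k 0<a)

  ^-mono-≤ : ∀ k → 0ℚ < a → a ≤ b → a ^ k ≤ b ^ k
  ^-mono-≤ zero 0<a a≤b = ℚ.≤-refl
  ^-mono-≤ {a} {b} (suc k) 0<a a≤b = begin
    a * a ^ k  ≤⟨ *ʳ-≤ (ℚ.<⇒≤ (^-pos k 0<a)) a≤b ⟩
    b * a ^ k  ≤⟨ *ˡ-≤ (ℚ.≤-trans (ℚ.<⇒≤ 0<a) a≤b) (^-mono-≤ k 0<a a≤b) ⟩
    b * b ^ k  ∎

  ^-mono-< : ∀ k → 0ℚ < a → a < b → a ^ suc k < b ^ suc k
  ^-mono-< {a} {b} k 0<a a<b = begin-strict
    a * a ^ k  <⟨ *ʳ-< (^-pos k 0<a) a<b ⟩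
    b * a ^ k  ≤⟨ *ˡ-≤ (ℚ.<⇒≤ (ℚ.<-trans 0<a a<b)) (^-mono-≤ k 0<a (ℚ.<⇒≤ a<b)) ⟩
    b * b ^ k  ∎

  1≤^ : ∀ k → 1ℚ ≤ a → 1ℚ ≤ a ^ k
  1≤^ zero 1≤a = ℚ.≤-refl
  1≤^ {a} (suc k) 1≤a = begin
    1ℚ         ≤⟨ 1≤a ⟩
    a          ≡⟨ sym (ℚ.*-identityʳ a) ⟩
    a * 1ℚ     ≤⟨ *ˡ-≤ (ℚ.≤-trans (ℚ.<⇒≤ 0<1) 1≤a) (1≤^ k 1≤a) ⟩
    a * a ^ k  ∎

  a≤a^k : ∀ k → 1ℚ ≤ a → a ≤ a ^ suc k
  a≤a^k {a} k 1≤a = begin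
    a          ≡⟨ sym (ℚ.*-identityʳ a) ⟩
    a * 1ℚ     ≤⟨ *ˡ-≤ (ℚ.≤-trans (ℚ.<⇒≤ 0<1) 1≤a) (1≤^ k 1≤a) ⟩
    a * a ^ k  ∎

  nat : ℕ → ℚ
  nat n = mkℚ (ℤ.+ n) 0 (ℕ.sym (ℕ.1-coprimeTo n))

  nat-suc : ∀ n → nat (suc n) ≡ 1ℚ + nat n
  nat-suc n = trans (sym (ℚ.↥p/↧p≡p (nat (suc n))))
    (cong (λ i → (ℤ.+ 1 ℤ.+ i) / 1) (sym (ℤ.*-identityʳ (ℤ.+ n))))

  <nat : ∀ q → ∃[ n ] q < nat n
  <nat q@(mkℚ i d _) = suc ℤ.∣ i ∣ , *<*
    (ℤ.≤-<-trans (ℤ.≤-trans (ℤ.≤-reflexive (ℤ.*-identityʳ i)) i≤∣i∣)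
                 (ℤ.+<+ (ℕ.m≤m*n (suc ℤ.∣ i ∣) (suc d))))
    where
    i≤∣i∣ : ∀ {i} → i ℤ.≤ ℤ.+ ℤ.∣ i ∣
    i≤∣i∣ {ℤ.+ n}      = ℤ.≤-refl
    i≤∣i∣ {ℤ.-[1+ n ]} = ℤ.-≤+

  archimedes : ∀ q → 0ℚ < d → ∃[ n ] q ≤ nat n * d
  archimedes {d} q 0<d =
    let n , lt = <nat (q * recip 0<d) in
    n , ℚ.<⇒≤ (subst (_< nat n * d) (cancel 0<d q) (*ʳ-< 0<d lt))

-- A non-negative real is given by its upper Dedekind cut, the set of
-- rationals strictly above it. The lower cut need not be carried along:
-- by locatedness it consists of the q such that some r > q is not in
-- the upper cut.

record ℝ≥0 : Set₁ where
  no-eta-equality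
  field
    Upper     : ℚ → Set
    pos       : Upper q → 0ℚ < q
    inhabited : ∃ Upper
    upward    : q < r → Upper q → Upper r
    rounded   : Upper q → ∃[ r ] r < q × Upper r
    located   : q < r → Upper r ⊎ ¬ Upper q

open ℝ≥0

infix 4 _≤ᵣ_

_≤ᵣ_ : ℝ≥0 → ℝ≥0 → Set
x ≤ᵣ y = ∀ {q} → Upper y q → Upper x q

record Positive (x : ℝ≥0) : Set where
  field
    bound   : ℚ
    0<bound : 0ℚ < bound
    ¬upper  : ¬ Upper x bound

fromℚ : (q : ℚ) → .{{NonNegative q}} → ℝ≥0
fromℚ q .Upper r     = q < r
fromℚ q .pos q<r     = ℚ.≤-<-trans (ℚ.nonNegative⁻¹ q) q<r
fromℚ q .inhabited   = q + 1ℚ , subst (_< q + 1ℚ) (ℚ.+-identityʳ q) (ℚ.+-monoʳ-< q 0<1)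
fromℚ q .upward      = λ s<r q<s → ℚ.<-trans q<s s<r
fromℚ q .rounded q<r = let s , q<s , s<r = ℚ.<-dense q<r in s , s<r , q<s
fromℚ q .located {s} {r} s<r with q ℚ.<? r
... | yes q<r = inj₁ q<r
... | no  q≮r = inj₂ λ q<s → q≮r (ℚ.<-trans q<s s<r)

∣_∣ᵣ : ℚ → ℝ≥0
∣ q ∣ᵣ = fromℚ ∣ q ∣ {{ℚ.∣-∣-nonNeg q}}

fromℕ : ℕ → ℝ≥0
fromℕ n = fromℚ (ℤ.+ n / 1) {{ℚ.normalize-nonNeg n 1}}

private
  upward≤ : ∀ x → q ≤ r → Upper x q → Upper x r
  upward≤ x q≤r u with s , s<q , u′ ← rounded x u = upward x (ℚ.<-≤-trans s<q q≤r) u′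

  above : ∀ x → Upper x q → ¬ Upper x r → r < q
  above {q} {r} x u ¬u with r ℚ.<? q
  ... | yes r<q = r<q
  ... | no  r≮q = ⊥-elim (¬u (upward≤ x (ℚ.≮⇒≥ r≮q) u))

  approx : ∀ x {ε} → 0ℚ < ε → ∃[ u ] Upper x u × ¬ Upper x (u - ε)
  approx x {ε} 0<ε = let u , U = inhabited x
                         n , u≤ = archimedes u 0<δ
                     in descend n u u≤ U
    where
    δ = ½ * ε

    0<δ : 0ℚ < δ
    0<δ = *-pos 0<½ 0<ε

    δ<ε : δ < ε
    δ<ε = subst (δ <_) (ℚ.*-identityˡ ε) (*ʳ-< 0<ε ½<1)

    descend : ∀ n u → u ≤ nat n * δ → Upper x u → ∃[ u ] Upper x u × ¬ Upper x (u - ε)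
    descend zero u u≤ U = ⊥-elim (ℚ.<-irrefl refl
      (ℚ.<-≤-trans (pos x U) (subst (u ≤_) (ℚ.*-zeroˡ δ) u≤)))
    descend (suc n) u u≤ U with located x (ℚ.+-monoʳ-< u (ℚ.neg-antimono-< δ<ε))
    ... | inj₂ ¬U = u , U , ¬U
    ... | inj₁ U′ = descend n (u - δ) (a≤c+b⇒a-c≤b u (nat n * δ) δ (subst (u ≤_) eq u≤)) U′
      where
      open +-*-Solver
      eq : nat (suc n) * δ ≡ δ + nat n * δ
      eq = trans (cong (_* δ) (nat-suc n))
        (trans (ℚ.*-distribʳ-+ δ 1ℚ (nat n)) (cong (_+ nat n * δ) (ℚ.*-identityˡ δ)))

  located-+ : ∀ x y ε → 0ℚ < ε → q + (ε + ε) ≡ r →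
              (∃[ u ] ∃[ v ] Upper x u × Upper y v × u + v < r) ⊎
              ¬ (∃[ u ] ∃[ v ] Upper x u × Upper y v × u + v < q)
  located-+ {q} {r} x y ε 0<ε q+2ε≡r
    = let u , U , ¬U = approx x 0<ε
          v , V , ¬V = approx y 0<ε in
    case u + v ℚ.<? r of λ where
      (yes lt) → inj₁ (u , v , U , V , lt)
      (no ≮r)  → inj₂ λ (u′ , v′ , U′ , V′ , lt) → ≮r (begin-strict
        u + v                      ≡⟨ eq u v ε ⟩
        (u - ε) + (v - ε) + (ε + ε)
          <⟨ ℚ.+-monoˡ-< (ε + ε) (ℚ.+-mono-< (above x U′ ¬U) (above y V′ ¬V)) ⟩
        u′ + v′ + (ε + ε)          <⟨ ℚ.+-monoˡ-< (ε + ε) lt ⟩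
        q + (ε + ε)                ≡⟨ q+2ε≡r ⟩
        r                          ∎)
    where
    open +-*-Solver
    eq : ∀ u v ε → u + v ≡ (u - ε) + (v - ε) + (ε + ε)
    eq = solve 3 (λ u v ε → u :+ v := (u :- ε) :+ (v :- ε) :+ (ε :+ ε)) refl

  located-* : ∀ x y {u₀ v₀} → Upper x u₀ → Upper y v₀ →
              ∀ ε → 0ℚ < ε → ε ≤ 1ℚ → q + ε * ((u₀ + 1ℚ) + (v₀ + 1ℚ)) ≤ r →
              (∃[ u ] ∃[ v ] Upper x u × Upper y v × u * v < r) ⊎
              ¬ (∃[ u ] ∃[ v ] Upper x u × Upper y v × u * v < q)
  located-* {q} {r} x y {u₀} {v₀} U₀ V₀ ε 0<ε ε≤1 q+εB≤r = result
    where
    near : ∀ z {w₀ w} → Upper z w₀ → ¬ Upper z (w - ε) → w ≤ w₀ + 1ℚ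
    near z {w₀} {w} W₀ ¬W = ℚ.≤-trans
      (a-c≤b⇒a≤b+c w w₀ ε (ℚ.<⇒≤ (above z W₀ ¬W))) (ℚ.+-monoʳ-≤ w₀ ε≤1)

    below : ∀ z {w w′} → Upper z w → ¬ Upper z (w - ε) → Upper z w′ →
            ∃[ l ] 0ℚ ≤ l × l ≤ w × l ≤ w′ × w ≤ l + ε
    below z {w} {w′} W ¬W W′ with ℚ.≤-total w w′
    ... | inj₁ w≤w′ = w , ℚ.<⇒≤ (pos z W) , ℚ.≤-refl , w≤w′ ,
      subst (_≤ w + ε) (ℚ.+-identityʳ w) (ℚ.+-monoʳ-≤ w (ℚ.<⇒≤ 0<ε))
    ... | inj₂ w′≤w = w′ , ℚ.<⇒≤ (pos z W′) , w′≤w , ℚ.≤-refl ,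
      a-c≤b⇒a≤b+c w w′ ε (ℚ.<⇒≤ (above z W′ ¬W))

    open +-*-Solver
    eq : ∀ l m u → (l + ε) * m + u * ε ≡ l * m + ε * (u + m)
    eq l m u = solve 4 (λ l m u ε → (l :+ ε) :* m :+ u :* ε := l :* m :+ ε :* (u :+ m))
      refl l m u ε

    close : ∀ u v → Upper x u → ¬ Upper x (u - ε) → Upper y v → ¬ Upper y (v - ε) →
            ∀ u′ v′ → Upper x u′ → Upper y v′ → u′ * v′ < q → u * v < r
    close u v U ¬U V ¬V u′ v′ U′ V′ lt
      with l , 0≤l , l≤u , l≤u′ , u≤l+ε ← below x U ¬U U′
         | m , 0≤m , m≤v , m≤v′ , v≤m+ε ← below y V ¬V V′ = begin-strict
      u * v                ≤⟨ *ˡ-≤ (ℚ.<⇒≤ (pos x U)) v≤m+ε ⟩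
      u * (m + ε)          ≡⟨ ℚ.*-distribˡ-+ u m ε ⟩
      u * m + u * ε        ≤⟨ ℚ.+-monoˡ-≤ (u * ε) (*ʳ-≤ 0≤m u≤l+ε) ⟩
      (l + ε) * m + u * ε  ≡⟨ eq l m u ⟩
      l * m + ε * (u + m)
        ≤⟨ ℚ.+-monoʳ-≤ (l * m) (*ˡ-≤ (ℚ.<⇒≤ 0<ε)
             (ℚ.+-mono-≤ (near x {w = u} U₀ ¬U) (ℚ.≤-trans m≤v (near y {w = v} V₀ ¬V)))) ⟩
      l * m + εB           ≤⟨ ℚ.+-monoˡ-≤ εB (*ʳ-≤ 0≤m l≤u′) ⟩
      u′ * m + εB          ≤⟨ ℚ.+-monoˡ-≤ εB (*ˡ-≤ (ℚ.<⇒≤ (pos x U′)) m≤v′) ⟩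
      u′ * v′ + εB         <⟨ ℚ.+-monoˡ-< εB lt ⟩
      q + εB               ≤⟨ q+εB≤r ⟩
      r                    ∎
      where
      εB = ε * ((u₀ + 1ℚ) + (v₀ + 1ℚ))

    result : (∃[ u ] ∃[ v ] Upper x u × Upper y v × u * v < r) ⊎
             ¬ (∃[ u ] ∃[ v ] Upper x u × Upper y v × u * v < q)
    result = let u , U , ¬U = approx x 0<ε
                 v , V , ¬V = approx y 0<ε in
      case u * v ℚ.<? r of λ where
      (yes lt) → inj₁ (u , v , U , V , lt)
      (no ≮r)  → inj₂ λ (u′ , v′ , U′ , V′ , lt) →
        ≮r (close u v U ¬U V ¬V u′ v′ U′ V′ lt)

  -- a positive ε ≤ 1 with ε b ≤ d, namely d / (b + d)
  smallε : 0ℚ < b → 0ℚ < d → ∃[ ε ] 0ℚ < ε × ε ≤ 1ℚ × ε * b ≤ d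
  smallε {b} {d} 0<b 0<d = d * i , *-pos 0<d 0<i ,
    subst (d * i ≤_) (inverseʳ 0<m) (*ʳ-≤ (ℚ.<⇒≤ 0<i) d≤m) ,
    subst (d * i * b ≤_) (cancel 0<m d) (*ˡ-≤ (ℚ.<⇒≤ (*-pos 0<d 0<i)) b≤m)
    where
    m = b + d
    0<m = +-pos 0<b 0<d
    i = recip 0<m
    0<i = 0<recip 0<m
    d≤m : d ≤ m
    d≤m = subst (_≤ m) (ℚ.+-identityˡ d) (ℚ.+-monoˡ-≤ d (ℚ.<⇒≤ 0<b))
    b≤m : b ≤ m
    b≤m = subst (_≤ m) (ℚ.+-identityʳ b) (ℚ.+-monoʳ-≤ b (ℚ.<⇒≤ 0<d))

infixl 6 _+ᵣ_
infixl 7 _*ᵣ_ _/ᵣ_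
infix  8 _^1/_

_+ᵣ_ : ℝ≥0 → ℝ≥0 → ℝ≥0
(x +ᵣ y) .Upper q = ∃[ u ] ∃[ v ] Upper x u × Upper y v × u + v < q
(x +ᵣ y) .pos (u , v , U , V , lt) = ℚ.<-trans (+-pos (pos x U) (pos y V)) lt
(x +ᵣ y) .inhabited =
  let u , U = inhabited x
      v , V = inhabited y in
  u + v + 1ℚ , u , v , U , V ,
  subst (_< u + v + 1ℚ) (ℚ.+-identityʳ (u + v)) (ℚ.+-monoʳ-< (u + v) 0<1)
(x +ᵣ y) .upward q<r (u , v , U , V , lt) = u , v , U , V , ℚ.<-trans lt q<r
(x +ᵣ y) .rounded (u , v , U , V , lt) =
  let s , lt′ , s<q = ℚ.<-dense lt in
  s , s<q , u , v , U , V , lt′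
(x +ᵣ y) .located {q} {r} q<r =
  located-+ x y (½ * (r - q)) (*-pos 0<½ (a<b⇒0<b-a q<r)) (eq q r)
  where
  open +-*-Solver
  eq : ∀ q r → q + (½ * (r - q) + ½ * (r - q)) ≡ r
  eq = solve 2 (λ q r → q :+ (con ½ :* (r :- q) :+ con ½ :* (r :- q)) := r) refl

_*ᵣ_ : ℝ≥0 → ℝ≥0 → ℝ≥0
(x *ᵣ y) .Upper q = ∃[ u ] ∃[ v ] Upper x u × Upper y v × u * v < q
(x *ᵣ y) .pos (u , v , U , V , lt) = ℚ.<-trans (*-pos (pos x U) (pos y V)) lt
(x *ᵣ y) .inhabited =
  let u , U = inhabited x
      v , V = inhabited y in
  u * v + 1ℚ , u , v , U , V ,
  subst (_< u * v + 1ℚ) (ℚ.+-identityʳ (u * v)) (ℚ.+-monoʳ-< (u * v) 0<1)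
(x *ᵣ y) .upward q<r (u , v , U , V , lt) = u , v , U , V , ℚ.<-trans lt q<r
(x *ᵣ y) .rounded (u , v , U , V , lt) =
  let s , lt′ , s<q = ℚ.<-dense lt in
  s , s<q , u , v , U , V , lt′
(x *ᵣ y) .located {q} {r} q<r =
  let u₀ , U₀ = inhabited x
      v₀ , V₀ = inhabited y
      ε , 0<ε , ε≤1 , εB≤r-q =
        smallε (+-pos (+-pos (pos x U₀) 0<1) (+-pos (pos y V₀) 0<1)) (a<b⇒0<b-a q<r)
  in located-* x y U₀ V₀ ε 0<ε ε≤1
       (subst (q + ε * ((u₀ + 1ℚ) + (v₀ + 1ℚ)) ≤_) (eq q r) (ℚ.+-monoʳ-≤ q εB≤r-q))
  where
  open +-*-Solver
  eq : ∀ q r → q + (r - q) ≡ r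
  eq = solve 2 (λ q r → q :+ (r :- q) := r) refl

-- 1/x < q when 1 < l q for some rational l with 0 < l ≤ x; here
-- ¬ Upper x l says l ≤ x.

_⁻¹ : (x : ℝ≥0) → {{Positive x}} → ℝ≥0
(x ⁻¹) .Upper q = 0ℚ < q × ∃[ l ] 0ℚ < l × ¬ Upper x l × 1ℚ < l * q
(x ⁻¹) .pos = proj₁
((x ⁻¹) {{x>0}}) .inhabited =
  i + i , +-pos 0<i 0<i , l , 0<l , ¬upper ,
  subst (1ℚ <_) (sym eq) (subst (_< 1ℚ + 1ℚ) (ℚ.+-identityʳ 1ℚ) (ℚ.+-monoʳ-< 1ℚ 0<1))
  where
  open Positive x>0 renaming (bound to l; 0<bound to 0<l)
  i = recip 0<l
  0<i = 0<recip 0<l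
  eq : l * (i + i) ≡ 1ℚ + 1ℚ
  eq = trans (ℚ.*-distribˡ-+ l i i) (cong (λ t → t + t) (inverseʳ 0<l))
(x ⁻¹) .upward q<r (0<q , l , 0<l , ¬U , 1<lq) =
  ℚ.<-trans 0<q q<r , l , 0<l , ¬U , ℚ.<-trans 1<lq (*ˡ-< 0<l q<r)
(x ⁻¹) .rounded {q} (0<q , l , 0<l , ¬U , 1<lq) =
  let m , 1<m , m<lq = ℚ.<-dense 1<lq in
  m * i , subst (m * i <_) eq₁ (*ʳ-< 0<i m<lq) ,
  *-pos (ℚ.<-trans 0<1 1<m) 0<i , l , 0<l , ¬U , subst (1ℚ <_) (sym (eq₂ m)) 1<m
  where
  i = recip 0<l
  0<i = 0<recip 0<l
  eq₂ : ∀ m → l * (m * i) ≡ m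
  eq₂ m = trans (ℚ.*-comm l (m * i)) (cancel 0<l m)
  eq₁ : l * q * i ≡ q
  eq₁ = trans (ℚ.*-comm (l * q) i) (trans (sym (ℚ.*-assoc i l q))
    (trans (cong (_* q) (inverseˡ 0<l)) (ℚ.*-identityˡ q)))
((x ⁻¹) {{x>0}}) .located {q} {r} q<r with 0ℚ ℚ.<? q
... | no 0≮q = inj₂ λ (0<q , _) → 0≮q 0<q
... | yes 0<q = result
  where
  0<r = ℚ.<-trans 0<q q<r
  r⁻¹ = recip 0<r
  q⁻¹ = recip 0<q

  r⁻¹<q⁻¹ : r⁻¹ < q⁻¹
  r⁻¹<q⁻¹ = subst₂ _<_ eq (trans (cong (_* q⁻¹) (inverseʳ 0<r)) (ℚ.*-identityˡ q⁻¹))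
    (*ʳ-< (0<recip 0<q) (*ʳ-< (0<recip 0<r) q<r))
    where
    eq : q * r⁻¹ * q⁻¹ ≡ r⁻¹
    eq = trans (cong (_* q⁻¹) (ℚ.*-comm q r⁻¹)) (trans (ℚ.*-assoc r⁻¹ q q⁻¹)
      (trans (cong (r⁻¹ *_) (inverseʳ 0<q)) (ℚ.*-identityʳ r⁻¹)))

  result : Upper (x ⁻¹) r ⊎ ¬ Upper (x ⁻¹) q
  result =
    let m  , r⁻¹<m , m<q⁻¹  = ℚ.<-dense r⁻¹<q⁻¹
        m′ , m<m′  , m′<q⁻¹ = ℚ.<-dense m<q⁻¹ in
    case located x m<m′ of λ where
      (inj₂ ¬U) → inj₁ (0<r , m , ℚ.<-trans (0<recip 0<r) r⁻¹<m , ¬U ,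
        subst (_< m * r) (inverseˡ 0<r) (*ʳ-< 0<r r⁻¹<m))
      (inj₁ U)  → inj₂ λ (_ , l , 0<l , ¬U , 1<lq) → ℚ.<-asym 1<lq (begin-strict
        l * q            <⟨ *ʳ-< 0<q (above x U ¬U) ⟩
        m′ * q           <⟨ *ʳ-< 0<q m′<q⁻¹ ⟩
        q⁻¹ * q          ≡⟨ inverseˡ 0<q ⟩
        1ℚ               ∎)

_/ᵣ_ : (x y : ℝ≥0) → {{Positive y}} → ℝ≥0
x /ᵣ y = x *ᵣ (y ⁻¹)

-- The k-th root of x lies strictly below q when x < sᵏ for some
-- rational s with 0 < s < q.

_^1/_ : ℝ≥0 → (k : ℕ) → .{{ℕ.NonZero k}} → ℝ≥0
(x ^1/ k) .Upper q = ∃[ s ] 0ℚ < s × s < q × Upper x (s ^ k)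
(x ^1/ k) .pos (s , 0<s , s<q , _) = ℚ.<-trans 0<s s<q
(x ^1/ suc k) .inhabited =
  s + 1ℚ , s , 0<s , subst (_< s + 1ℚ) (ℚ.+-identityʳ s) (ℚ.+-monoʳ-< s 0<1) ,
  upward≤ x (ℚ.≤-trans u≤s (a≤a^k k 1≤s)) U
  where
  u = proj₁ (inhabited x)
  U = proj₂ (inhabited x)
  s = u + 1ℚ
  0<s = +-pos (pos x U) 0<1
  u≤s : u ≤ s
  u≤s = subst (_≤ s) (ℚ.+-identityʳ u) (ℚ.+-monoʳ-≤ u (ℚ.<⇒≤ 0<1))
  1≤s : 1ℚ ≤ s
  1≤s = subst (_≤ s) (ℚ.+-identityˡ 1ℚ) (ℚ.+-monoˡ-≤ 1ℚ (ℚ.<⇒≤ (pos x U)))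
(x ^1/ k) .upward q<r (s , 0<s , s<q , U) = s , 0<s , ℚ.<-trans s<q q<r , U
(x ^1/ k) .rounded (s , 0<s , s<q , U) =
  let t , s<t , t<q = ℚ.<-dense s<q in
  t , t<q , s , 0<s , s<t , U
(x ^1/ suc k) .located {q} q<r = case 0ℚ ℚ.<? q of λ where
  (no 0≮q)  → inj₂ λ (s , 0<s , s<q , _) → 0≮q (ℚ.<-trans 0<s s<q)
  (yes 0<q) → let m , q<m , m<r = ℚ.<-dense q<r in
    case located x (^-mono-< k 0<q q<m) of λ where
      (inj₁ U)  → inj₁ (m , ℚ.<-trans 0<q q<m , m<r , U)
      (inj₂ ¬U) → inj₂ λ (s , 0<s , s<q , U) → ¬U (upward x (^-mono-< k 0<s s<q) U)

instance
  fromℕ-pos : ∀ {n} .{{_ : ℕ.NonZero n}} → Positive (fromℕ n)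
  fromℕ-pos {n} = record
    { bound   = ℤ.+ n / 1
    ; 0<bound = ℚ.positive⁻¹ (ℤ.+ n / 1) {{ℚ.normalize-pos n 1}}
    ; ¬upper  = ℚ.<-irrefl refl
    }

  ^1/-pos : ∀ {x k} .{{_ : ℕ.NonZero k}} {{_ : Positive x}} → Positive (x ^1/ k)
  ^1/-pos {x} {suc k} {{_}} {{x>0}} = record
    { bound   = m
    ; 0<bound = 0<m
    ; ¬upper  = λ (s , 0<s , s<m , U) → ¬upper (upward≤ x (s^k≤l s 0<s s<m) U)
    }
    where
    open Positive x>0 renaming (bound to l; 0<bound to 0<l)
    -- m = min(1, l), so that sᵏ ≤ l for 0 < s < m
    m = 1ℚ ⊓ l

    0<m : 0ℚ < m
    0<m with ℚ.⊓-sel 1ℚ l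
    ... | inj₁ eq = subst (0ℚ <_) (sym eq) 0<1
    ... | inj₂ eq = subst (0ℚ <_) (sym eq) 0<l

    ^≤1 : ∀ j {s} → 0ℚ < s → s ≤ 1ℚ → s ^ j ≤ 1ℚ
    ^≤1 zero 0<s s≤1 = ℚ.≤-refl
    ^≤1 (suc j) {s} 0<s s≤1 = begin
      s * s ^ j  ≤⟨ *ˡ-≤ (ℚ.<⇒≤ 0<s) (^≤1 j 0<s s≤1) ⟩
      s * 1ℚ     ≡⟨ ℚ.*-identityʳ s ⟩
      s          ≤⟨ s≤1 ⟩
      1ℚ         ∎

    s^k≤l : ∀ s → 0ℚ < s → s < m → s ^ suc k ≤ l
    s^k≤l s 0<s s<m = begin
      s * s ^ k  ≤⟨ *ˡ-≤ (ℚ.<⇒≤ 0<s) (^≤1 k 0<s (ℚ.≤-trans (ℚ.<⇒≤ s<m) (ℚ.p⊓q≤p 1ℚ l))) ⟩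
      s * 1ℚ     ≡⟨ ℚ.*-identityʳ s ⟩
      s          ≤⟨ ℚ.≤-trans (ℚ.<⇒≤ s<m) (ℚ.p⊓q≤q 1ℚ l) ⟩
      l          ∎

{-# OPTIONS --safe #-}

-- Idea. For residues X, Y and a finite set A of exponents let F(X, Y) be the
-- number of (a, b) ∈ A × A with gᵃ X − gᵇ Y ≡ h (mod p). For fixed (a, b) this
-- is a line with p points, and because h ≢ 0 two such lines meet in at most one
-- point unless they coincide (the Sidon property of the powers of g). The
-- second moment method over all p² points gives
--
--     ∑ (p F(X, Y) − |A|²)²  ≤  4 p³ |A|²
--
-- as soon as no residue is gᵃ for more than two a ∈ A. At the M² points
-- (g⁻ⁱ, g⁻ʲ), i, j < M, with A an interval of length N + M, one has J₁ ≤ F; at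
-- the points (gⁱ, gʲ), with A an interval of length N − M, one has F ≤ J₁.
-- Hence |p J₁ − N²| ≤ D + 3 N M with M² D² ≤ 16 p³ N², and M ≈ min(N, p^(3/4))
-- balances the two terms.

module Submission where

open import Data.Bool using (true; false; if_then_else_)
open import Data.Empty using (⊥-elim)
open import Data.Integer as ℤ using (ℤ; 0ℤ; 1ℤ; +_; -[1+_])
open import Data.Integer.Coprimality using (Coprime)
import Data.Integer.DivMod as ℤ
import Data.Integer.Divisibility.Signed as ℤ
import Data.Integer.Properties as ℤ
open import Data.Integer.Tactic.RingSolver using (solve-∀)
open import Data.List using (List; []; _∷_; _++_; map; length; filter; upTo; cartesianProduct)
open import Data.List.Membership.Propositional using (_∈_)
open import Data.List.Membership.Propositional.Properties using (∈-upTo⁻; ∈-cartesianProduct⁺;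
  ∈-cartesianProduct⁻; ∈-++⁺ˡ; ∈-++⁺ʳ; ∈-∃++; ∈-++⁻; ∈-upTo⁺; ∈-map⁻; ∈-map⁺)
open import Data.List.Properties using (length-++; length-upTo; length-map)
open import Data.List.Relation.Unary.All using ([]; _∷_; lookup)
open import Data.List.Relation.Unary.AllPairs using ([]; _∷_)
open import Data.List.Relation.Unary.Any using (here; there)
open import Data.List.Relation.Unary.Unique.Propositional using (Unique)
import Data.List.Relation.Unary.Unique.Propositional.Properties as Unique
open import Data.Nat using (ℕ; zero; suc; _+_; _*_; _∸_; _≤_; _<_; _^_; NonZero; z≤n;
  s≤s; z<s; >-nonZero; ∣_-_∣; nonTrivial⇒n>1; >-nonZero⁻¹)
import Data.Nat.Coprimality as Coprime
open import Data.Nat.Coprimality using (prime⇒coprime; coprime-Bézout; 1-coprimeTo)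
open import Data.Nat.DivMod using (_%_; m≡m%n+[m/n]*n; m%n<n) renaming (_/_ to _div_)
open import Data.Nat.Divisibility using (>⇒∤) renaming (_∣_ to _∣ℕ_)
open import Data.Nat.GCD using (module Bézout)
open import Data.Nat.Primality using (Prime; euclidsLemma; prime⇒nonTrivial; prime⇒nonZero)
open import Data.Nat.Properties hiding (_≟_)
open import Data.Nat.Solver using (module +-*-Solver)
open import Data.Product using (∃-syntax; Σ-syntax; _×_; _,_; proj₁; proj₂)
open import Data.Rational as ℚ using (ℚ; mkℚ; 0ℚ; 1ℚ; ½; toℚᵘ; _/_; _-_)
import Data.Rational.Properties as ℚ
open import Data.Rational.Solver using () renaming (module +-*-Solver to ℚ-Solver)
open import Data.Rational.Unnormalised as ℚᵘ using (mkℚᵘ; *≡*)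
import Data.Rational.Unnormalised.Properties as ℚᵘ
open import Data.Sum using (_⊎_; inj₁; inj₂; [_,_]′)
open import Defs
open import Level using (0ℓ)
open import Relation.Binary.PropositionalEquality using (_≡_; refl; sym; trans; cong; cong₂;
  subst; subst₂)
open import Relation.Nullary using (¬_; yes; no; Dec; does)
open import Relation.Nullary.Decidable using (_×-dec_)
open import Relation.Unary using (Pred; Decidable)

private variable
  A B : Set
  P Q : Set

-- Finite sums over lists

∑ : List A → (A → ℕ) → ℕ
∑ []       f = 0
∑ (x ∷ xs) f = f x + ∑ xs f

∑-cong : ∀ (xs : List A) {f g} → (∀ x → f x ≡ g x) → ∑ xs f ≡ ∑ xs g
∑-cong []       eq = refl
∑-cong (x ∷ xs) eq = cong₂ _+_ (eq x) (∑-cong xs eq)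

∑-mono : ∀ (xs : List A) {f g} → (∀ x → x ∈ xs → f x ≤ g x) → ∑ xs f ≤ ∑ xs g
∑-mono []       le = z≤n
∑-mono (x ∷ xs) le = +-mono-≤ (le x (here refl)) (∑-mono xs λ y y∈ → le y (there y∈))

∑-+ : ∀ (xs : List A) f g → ∑ xs (λ x → f x + g x) ≡ ∑ xs f + ∑ xs g
∑-+ []       f g = refl
∑-+ (x ∷ xs) f g = trans (cong (_+_ (f x + g x)) (∑-+ xs f g))
  (solve 4 (λ a b c d → a :+ b :+ (c :+ d) := a :+ c :+ (b :+ d)) refl (f x) (g x) (∑ xs f) (∑ xs g))
  where open +-*-Solver

∑-*ˡ : ∀ (xs : List A) c f → ∑ xs (λ x → c * f x) ≡ c * ∑ xs f
∑-*ˡ []       c f = sym (*-zeroʳ c)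
∑-*ˡ (x ∷ xs) c f = trans (cong (_+_ (c * f x)) (∑-*ˡ xs c f)) (sym (*-distribˡ-+ c (f x) _))

∑-*ʳ : ∀ (xs : List A) c f → ∑ xs (λ x → f x * c) ≡ ∑ xs f * c
∑-*ʳ xs c f = trans (∑-cong xs λ x → *-comm (f x) c) (trans (∑-*ˡ xs c f) (*-comm c _))

∑-const : ∀ (xs : List A) c → ∑ xs (λ _ → c) ≡ length xs * c
∑-const []       c = refl
∑-const (x ∷ xs) c = cong (_+_ c) (∑-const xs c)

∑-++ : ∀ (xs ys : List A) f → ∑ (xs ++ ys) f ≡ ∑ xs f + ∑ ys f
∑-++ []       ys f = refl
∑-++ (x ∷ xs) ys f = trans (cong (_+_ (f x)) (∑-++ xs ys f)) (sym (+-assoc (f x) _ _))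

∑-map : ∀ (φ : A → B) xs f → ∑ (map φ xs) f ≡ ∑ xs (λ x → f (φ x))
∑-map φ []       f = refl
∑-map φ (x ∷ xs) f = cong (_+_ (f (φ x))) (∑-map φ xs f)

∑-swap : ∀ (xs : List A) (ys : List B) (f : A → B → ℕ) →
         ∑ xs (λ x → ∑ ys (f x)) ≡ ∑ ys (λ y → ∑ xs (λ x → f x y))
∑-swap []       ys f = sym (trans (∑-const ys 0) (*-zeroʳ (length ys)))
∑-swap (x ∷ xs) ys f = trans (cong (_+_ (∑ ys (f x))) (∑-swap xs ys f)) (sym (∑-+ ys (f x) _))

∑-cartesianProduct : ∀ (xs : List A) (ys : List B) f →
  ∑ (cartesianProduct xs ys) f ≡ ∑ xs (λ x → ∑ ys (λ y → f (x , y)))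
∑-cartesianProduct []       ys f = refl
∑-cartesianProduct (x ∷ xs) ys f = trans (∑-++ (map (x ,_) ys) _ f)
  (cong₂ _+_ (∑-map (x ,_) ys f) (∑-cartesianProduct xs ys f))

∑²-* : ∀ (xs : List A) (ys : List B) f g →
  ∑ (cartesianProduct xs ys) (λ (x , y) → f x * g y) ≡ ∑ xs f * ∑ ys g
∑²-* xs ys f g = trans (∑-cartesianProduct xs ys _)
  (trans (∑-cong xs λ x → ∑-*ˡ ys (f x) g) (∑-*ʳ xs _ f))

∑*∑ : ∀ (xs : List A) (ys : List B) f g →
  ∑ xs f * ∑ ys g ≡ ∑ xs (λ x → ∑ ys (λ y → f x * g y))
∑*∑ xs ys f g = trans (sym (∑-*ʳ xs _ f)) (∑-cong xs λ x → sym (∑-*ˡ ys (f x) g))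

length-cartesianProduct : ∀ (xs : List A) (ys : List B) →
  length (cartesianProduct xs ys) ≡ length xs * length ys
length-cartesianProduct []       ys = refl
length-cartesianProduct (x ∷ xs) ys = trans (length-++ (map (x ,_) ys))
  (cong₂ _+_ (length-map (x ,_) ys) (length-cartesianProduct xs ys))

∈⇒≤∑ : ∀ {xs : List A} {x} f → x ∈ xs → f x ≤ ∑ xs f
∈⇒≤∑ {xs = _ ∷ xs} f (here refl) = m≤m+n (f _) (∑ xs f)
∈⇒≤∑ {xs = y ∷ _} f (there x∈) = ≤-trans (∈⇒≤∑ f x∈) (m≤n+m _ (f y))

-- The injection is given as a relation, so that partners in `ys` can be found case by case.
-- Induction on `xs`: the partner of the head is deleted from `ys`, and injectivity of `R` ensures
-- that no later entry is matched with the deleted occurrence.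
∑-inject : ∀ (R : A → B → Set) {xs ys f g} → Unique xs →
  (∀ {x x′ y} → x ∈ xs → x′ ∈ xs → R x y → R x′ y → x ≡ x′) →
  (∀ {x} → x ∈ xs → ∃[ y ] y ∈ ys × R x y × f x ≤ g y) →
  ∑ xs f ≤ ∑ ys g
∑-inject R {[]} _ inj tot = z≤n
∑-inject R {x ∷ xs} {ys} {f} {g} (x∉ ∷ uniq) inj tot
  with y , y∈ , Rxy , fx≤gy ← tot (here refl)
  with as , bs , refl ← ∈-∃++ y∈ = begin
    f x + ∑ xs f          ≤⟨ +-mono-≤ fx≤gy (∑-inject R {ys = as ++ bs} uniq
                               (λ x∈ x′∈ → inj (there x∈) (there x′∈)) tot′) ⟩
    g y + ∑ (as ++ bs) g  ≡⟨ cong (_+_ (g y)) (∑-++ as bs g) ⟩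
    g y + (∑ as g + ∑ bs g)
      ≡⟨ solve 3 (λ a b c → a :+ (b :+ c) := b :+ (a :+ c)) refl (g y) (∑ as g) (∑ bs g) ⟩
    ∑ as g + (g y + ∑ bs g)  ≡⟨ ∑-++ as (y ∷ bs) g ⟨
    ∑ (as ++ y ∷ bs) g    ∎
  where
  open ≤-Reasoning
  open +-*-Solver
  tot′ : ∀ {x′} → x′ ∈ xs → ∃[ y′ ] y′ ∈ as ++ bs × R x′ y′ × f x′ ≤ g y′
  tot′ x′∈ with y′ , y′∈ , Rx′y′ , le ← tot (there x′∈) with ∈-++⁻ as y′∈
  ... | inj₁ ∈as = y′ , ∈-++⁺ˡ ∈as , Rx′y′ , le
  -- Here x′ would share its partner with the head x, so x ≡ x′, against uniqueness of the list.
  ... | inj₂ (here refl) = ⊥-elim (lookup x∉ x′∈ (inj (here refl) (there x′∈) Rxy Rx′y′))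
  ... | inj₂ (there ∈bs) = y′ , ∈-++⁺ʳ as ∈bs , Rx′y′ , le

-- Indicators of decidable propositions and counting

⟦_⟧ : Dec P → ℕ
⟦ d ⟧ = if does d then 1 else 0

⟦⟧-mono : (d : Dec P) (e : Dec Q) → (P → Q) → ⟦ d ⟧ ≤ ⟦ e ⟧
⟦⟧-mono (no _)  e       f = z≤n
⟦⟧-mono (yes p) (yes q) f = s≤s z≤n
⟦⟧-mono (yes p) (no ¬q) f = ⊥-elim (¬q (f p))

⟦⟧-× : (d : Dec P) (e : Dec Q) → ⟦ d ⟧ * ⟦ e ⟧ ≡ ⟦ d ×-dec e ⟧
⟦⟧-× (no _)  e       = refl
⟦⟧-× (yes _) (no _)  = refl
⟦⟧-× (yes _) (yes _) = refl

⟦⟧≡0 : (d : Dec P) → ¬ P → ⟦ d ⟧ ≡ 0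
⟦⟧≡0 (yes p) ¬p = ⊥-elim (¬p p)
⟦⟧≡0 (no _)  ¬p = refl

1≤⟦⟧ : (d : Dec P) → P → 1 ≤ ⟦ d ⟧
1≤⟦⟧ (yes _) p = s≤s z≤n
1≤⟦⟧ (no ¬p) p = ⊥-elim (¬p p)

length-filter≡∑ : ∀ {P : Pred A 0ℓ} (P? : Decidable P) xs →
  length (filter P? xs) ≡ ∑ xs (λ x → ⟦ P? x ⟧)
length-filter≡∑ P? [] = refl
length-filter≡∑ P? (x ∷ xs) with does (P? x)
... | true  = cong suc (length-filter≡∑ P? xs)
... | false = length-filter≡∑ P? xs

-- Turns the uniqueness arguments below into counts: one exponent per residue in a short window, one
-- `Y` on a line for each `X`, one common point of two distinct lines.
∑⟦⟧≤1 : ∀ {P : Pred A 0ℓ} (P? : Decidable P) {xs} → Unique xs →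
  (∀ {x y} → x ∈ xs → y ∈ xs → P x → P y → x ≡ y) → ∑ xs (λ x → ⟦ P? x ⟧) ≤ 1
∑⟦⟧≤1 P? {[]} _ _ = z≤n
∑⟦⟧≤1 P? {x ∷ xs} (x∉ ∷ uniq) same with P? x
... | no _ = ∑⟦⟧≤1 P? uniq (λ x∈ y∈ → same (there x∈) (there y∈))
... | yes Px = s≤s (begin
    ∑ xs (λ y → ⟦ P? y ⟧)  ≤⟨ ∑-mono xs (λ y y∈ → ≤-reflexive
        (⟦⟧≡0 (P? y) λ Py → lookup x∉ y∈ (same (here refl) (there y∈) Px Py))) ⟩
    ∑ xs (λ _ → 0)         ≡⟨ ∑-const xs 0 ⟩
    length xs * 0          ≡⟨ *-zeroʳ (length xs) ⟩
    0                      ∎)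
  where open ≤-Reasoning

-- Integers modulo p

module Mod (p : ℕ) .{{_ : NonZero p}} where

  infix 4 _≈_ _≉_ _≈?_

  -- A record, so that a and b can be inferred from a ≈ b.
  record _≈_ (a b : ℤ) : Set where
    constructor mk
    field divides : a ≡ b [mod p ]
  open _≈_ public

  _≉_ : ℤ → ℤ → Set
  a ≉ b = ¬ a ≈ b

  ≢⇒≉ : ∀ {a b} → ¬ (a ≡ b [mod p ]) → a ≉ b
  ≢⇒≉ a≢b (mk d) = a≢b d

  _≈?_ : ∀ a b → Dec (a ≈ b)
  a ≈? b with + p ℤ.∣? a ℤ.- b
  ... | yes d = yes (mk d)
  ... | no ¬d = no λ (mk d) → ¬d d

  via : ∀ {a b c} → c ≡ a ℤ.- b → + p ℤ.∣ c → a ≈ b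
  via eq d = mk (subst (+ p ℤ.∣_) eq d)

  ≈-reflexive : ∀ {a b} → a ≡ b → a ≈ b
  ≈-reflexive {a} refl = via (sym (ℤ.+-inverseʳ a)) (ℤ.divides 0ℤ refl)

  ≈-refl : ∀ {a} → a ≈ a
  ≈-refl = ≈-reflexive refl

  ≈-sym : ∀ {a b} → a ≈ b → b ≈ a
  ≈-sym {a} {b} (mk d) = via (eq a b) (ℤ.∣m⇒∣-m d)
    where
    eq : ∀ a b → ℤ.- (a ℤ.- b) ≡ b ℤ.- a
    eq = solve-∀

  ≈-trans : ∀ {a b c} → a ≈ b → b ≈ c → a ≈ c
  ≈-trans {a} {b} {c} (mk d) (mk e) = via (eq a b c) (ℤ.∣m∣n⇒∣m+n d e)
    where
    eq : ∀ a b c → (a ℤ.- b) ℤ.+ (b ℤ.- c) ≡ a ℤ.- c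
    eq = solve-∀

  +-cong : ∀ {a b c d} → a ≈ b → c ≈ d → a ℤ.+ c ≈ b ℤ.+ d
  +-cong {a} {b} {c} {d} (mk e) (mk f) = via (eq a b c d) (ℤ.∣m∣n⇒∣m+n e f)
    where
    eq : ∀ a b c d → (a ℤ.- b) ℤ.+ (c ℤ.- d) ≡ a ℤ.+ c ℤ.- (b ℤ.+ d)
    eq = solve-∀

  neg-cong : ∀ {a b} → a ≈ b → ℤ.- a ≈ ℤ.- b
  neg-cong {a} {b} (mk d) = via (eq a b) (ℤ.∣m⇒∣-m d)
    where
    eq : ∀ a b → ℤ.- (a ℤ.- b) ≡ ℤ.- a ℤ.- ℤ.- b
    eq = solve-∀

  sub-cong : ∀ {a b c d} → a ≈ b → c ≈ d → a ℤ.- c ≈ b ℤ.- d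
  sub-cong e f = +-cong e (neg-cong f)

  *-cong : ∀ {a b c d} → a ≈ b → c ≈ d → a ℤ.* c ≈ b ℤ.* d
  *-cong {a} {b} {c} {d} (mk e) (mk f) =
    via (eq a b c d) (ℤ.∣m∣n⇒∣m+n (ℤ.∣n⇒∣m*n c e) (ℤ.∣n⇒∣m*n b f))
    where
    eq : ∀ a b c d → c ℤ.* (a ℤ.- b) ℤ.+ b ℤ.* (c ℤ.- d) ≡ a ℤ.* c ℤ.- b ℤ.* d
    eq = solve-∀

  *-congˡ : ∀ {a b} c → a ≈ b → c ℤ.* a ≈ c ℤ.* b
  *-congˡ c e = *-cong (≈-refl {c}) e

  ^-cong : ∀ {a b} k → a ≈ b → a ℤ.^ k ≈ b ℤ.^ k
  ^-cong zero    e = ≈-refl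
  ^-cong (suc k) e = *-cong e (^-cong k e)

  residues : List ℤ
  residues = map +_ (upTo p)

  representative : ∀ z → ∃[ r ] r ∈ residues × z ≈ r
  representative z = + (z ℤ.%ℕ p) , ∈-map⁺ +_ (∈-upTo⁺ (ℤ.n%ℕd<d z p)) ,
    via (trans (eq (+ (z ℤ.%ℕ p)) _) (cong (ℤ._- + (z ℤ.%ℕ p)) (sym (ℤ.a≡a%ℕn+[a/ℕn]*n z p))))
        (ℤ.divides (z ℤ./ℕ p) refl)
    where
    eq : ∀ r m → m ≡ (r ℤ.+ m) ℤ.- r
    eq = solve-∀

  residues-unique : Unique residues
  residues-unique = Unique.map⁺ (λ { refl → refl }) (Unique.upTo⁺ p)

  length-residues : length residues ≡ p
  length-residues = trans (length-map +_ (upTo p)) (length-upTo p)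

  private
    -- The difference j - i is a multiple of p below p, hence zero.
    small-≈ : ∀ {i j} → i ≤ j → j < p → + j ≈ + i → i ≡ j
    small-≈ {i} {j} i≤j j<p (mk d)
      with j ∸ i in eq | ℤ.∣⇒∣ᵤ (subst (+ p ℤ.∣_) (trans (ℤ.m-n≡m⊖n j i) (ℤ.⊖-≥ i≤j)) d)
    ... | zero  | _   = ≤-antisym i≤j (m∸n≡0⇒m≤n eq)
    ... | suc k | p∣k = ⊥-elim (>⇒∤ (≤-<-trans (≤-trans (≤-reflexive (sym eq)) (m∸n≤m j i)) j<p) p∣k)

  <p-≈⇒≡ : ∀ {i j} → i < p → j < p → + i ≈ + j → i ≡ j
  <p-≈⇒≡ {i} {j} i<p j<p e with ≤-total i j
  ... | inj₁ i≤j = small-≈ i≤j j<p (≈-sym e)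
  ... | inj₂ j≤i = sym (small-≈ j≤i i<p e)

  residue-≈⇒≡ : ∀ {x y} → x ∈ residues → y ∈ residues → x ≈ y → x ≡ y
  residue-≈⇒≡ x∈ y∈ e
    with i , i∈ , refl ← ∈-map⁻ +_ x∈ | j , j∈ , refl ← ∈-map⁻ +_ y∈ =
    cong +_ (<p-≈⇒≡ (∈-upTo⁻ i∈) (∈-upTo⁻ j∈) e)

  -- Bézout's identity for |a| and p, which over ℕ comes in two forms according to which multiple is
  -- larger; the sign of `a` is then moved to the inverse.
  inverse : ∀ a → Coprime a (+ p) → ∃[ b ] a ℤ.* b ≈ 1ℤ
  inverse a co = signed a (absolute ℤ.∣ a ∣ (coprime-Bézout co))
    where
    castˡ : ∀ {d x m y n} → d + y * n ≡ x * m → + d ℤ.+ + y ℤ.* + n ≡ + x ℤ.* + m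
    castˡ {d} {x} {m} {y} {n} eq = trans (cong (λ t → + d ℤ.+ t) (sym (ℤ.pos-* y n)))
      (trans (sym (ℤ.pos-+ d (y * n))) (trans (cong +_ eq) (ℤ.pos-* x m)))

    absolute : ∀ m → Bézout.Identity 1 m p → ∃[ b ] + m ℤ.* b ≈ 1ℤ
    absolute m (Bézout.+- x y eq) = + x , via (trans (lem (+ y ℤ.* + p))
      (cong (ℤ._- 1ℤ) (trans (castˡ {1} {x} {m} {y} {p} eq) (ℤ.*-comm (+ x) (+ m))))) (ℤ.divides (+ y) refl)
      where
      lem : ∀ m → m ≡ (1ℤ ℤ.+ m) ℤ.- 1ℤ
      lem = solve-∀
    absolute m (Bézout.-+ x y eq) = ℤ.- + x , via (trans
      (cong ℤ.-_ (sym (castˡ {1} {y} {p} {x} {m} eq))) (lem (+ x) (+ m))) (ℤ.∣m⇒∣-m (ℤ.divides (+ y) refl))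
      where
      lem : ∀ x m → ℤ.- (1ℤ ℤ.+ x ℤ.* m) ≡ m ℤ.* ℤ.- x ℤ.- 1ℤ
      lem = solve-∀

    signed : ∀ a → ∃[ b ] + ℤ.∣ a ∣ ℤ.* b ≈ 1ℤ → ∃[ b ] a ℤ.* b ≈ 1ℤ
    signed (+ n)      inv     = inv
    signed (-[1+ n ]) (b , e) = ℤ.- b , ≈-trans (≈-reflexive (lem (+ suc n) b)) e
      where
      lem : ∀ m b → ℤ.- m ℤ.* ℤ.- b ≡ m ℤ.* b
      lem = solve-∀

  ^-*-inverse : ∀ {a b} → a ℤ.* b ≈ 1ℤ → ∀ k → a ℤ.^ k ℤ.* b ℤ.^ k ≈ 1ℤ
  ^-*-inverse e zero = ≈-refl
  ^-*-inverse {a} {b} e (suc k) = ≈-trans (≈-reflexive (lem a b (a ℤ.^ k) (b ℤ.^ k)))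
    (*-cong e (^-*-inverse e k))
    where
    lem : ∀ a b c d → a ℤ.* c ℤ.* (b ℤ.* d) ≡ a ℤ.* b ℤ.* (c ℤ.* d)
    lem = solve-∀

module ModPrime {p : ℕ} (prime : Prime p) where

  instance
    p≢0 : NonZero p
    p≢0 = prime⇒nonZero prime

  open Mod p {{p≢0}} public

  integral : ∀ a b → a ℤ.* b ≈ 0ℤ → a ≈ 0ℤ ⊎ b ≈ 0ℤ
  integral a b (mk d) with euclidsLemma ℤ.∣ a ∣ ℤ.∣ b ∣ prime
    (subst (p ∣ℕ_) (trans (cong ℤ.∣_∣ (ℤ.+-identityʳ (a ℤ.* b))) (ℤ.abs-* a b)) (ℤ.∣⇒∣ᵤ d))
  ... | inj₁ p∣a = inj₁ (via (sym (ℤ.+-identityʳ a)) (ℤ.∣ᵤ⇒∣ p∣a))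
  ... | inj₂ p∣b = inj₂ (via (sym (ℤ.+-identityʳ b)) (ℤ.∣ᵤ⇒∣ p∣b))

  *-cancelˡ : ∀ {a b} c → c ≉ 0ℤ → c ℤ.* a ≈ c ℤ.* b → a ≈ b
  *-cancelˡ {a} {b} c c≉0 (mk d) with integral c (a ℤ.- b) (via (eq a b c) d)
    where
    eq : ∀ a b c → c ℤ.* a ℤ.- c ℤ.* b ≡ c ℤ.* (a ℤ.- b) ℤ.- 0ℤ
    eq = solve-∀
  ... | inj₁ c≈0    = ⊥-elim (c≉0 c≈0)
  ... | inj₂ (mk e) = via (ℤ.+-identityʳ (a ℤ.- b)) e

  1≉0 : 1ℤ ≉ 0ℤ
  1≉0 (mk d) = >⇒∤ (nonTrivial⇒n>1 p) (ℤ.∣⇒∣ᵤ d)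
    where
    instance _ = prime⇒nonTrivial prime

  unit⇒≉0 : ∀ {a b} → a ℤ.* b ≈ 1ℤ → a ≉ 0ℤ
  unit⇒≉0 {a} {b} e a≈0 = 1≉0 (≈-trans (≈-sym e) (*-cong a≈0 (≈-refl {b})))

-- Powers of a primitive root and the lines gᵃ X − gᵇ Y ≡ h

-- Half-open interval from c up to c + k. `[1⋯ N ]` and `window 1 N` agree by computation, so the
-- lemmas on windows apply to both.
window : ℕ → ℕ → List ℕ
window c k = map (_+_ c) (upTo k)

window-unique : ∀ c k → Unique (window c k)
window-unique c k = Unique.map⁺ (+-cancelˡ-≡ c _ _) (Unique.upTo⁺ k)

∈-window⁺ : ∀ {c k i} → c ≤ i → i < c + k → i ∈ window c k
∈-window⁺ {c} {k} {i} c≤i i<c+k = subst (_∈ window c k) (m+[n∸m]≡n c≤i)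
  (∈-map⁺ (_+_ c) (∈-upTo⁺ (+-cancelˡ-< c _ _ (subst (_< c + k) (sym (m+[n∸m]≡n c≤i)) i<c+k))))

∈-window⁻ : ∀ {c k i} → i ∈ window c k → c ≤ i × i < c + k
∈-window⁻ {c} i∈ with j , j∈ , refl ← ∈-map⁻ (_+_ c) i∈ = m≤m+n c j , +-monoʳ-< c (∈-upTo⁻ j∈)

length-window : ∀ c k → length (window c k) ≡ k
length-window c k = trans (length-map (_+_ c) (upTo k)) (length-upTo k)

∣m+n-m∣≡n : ∀ m n → ∣ m + n - m ∣ ≡ n
∣m+n-m∣≡n m n = trans (∣-∣-comm (m + n) m) (∣m-m+n∣≡n m n)

-- The expansion of (m - n)² with the cross term moved to the left, which keeps the second moment
-- computation within ℕ.
∣m-n∣²+2mn≡m²+n² : ∀ m n → ∣ m - n ∣ * ∣ m - n ∣ + 2 * m * n ≡ m * m + n * n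
∣m-n∣²+2mn≡m²+n² m n with ≤-total m n
... | inj₁ m≤n with k , refl ← m≤n⇒∃[o]m+o≡n m≤n =
  trans (cong (λ t → t * t + 2 * m * (m + k)) (trans (∣-∣-comm m (m + k)) (∣m+n-m∣≡n m k)))
    (solve 2 (λ m k → k :* k :+ con 2 :* m :* (m :+ k) := m :* m :+ (m :+ k) :* (m :+ k)) refl m k)
  where open +-*-Solver
... | inj₂ n≤m with k , refl ← m≤n⇒∃[o]m+o≡n n≤m =
  trans (cong (λ t → t * t + 2 * (n + k) * n) (∣m+n-m∣≡n n k))
    (solve 2 (λ n k → k :* k :+ con 2 :* (n :+ k) :* n := (n :+ k) :* (n :+ k) :+ n :* n) refl n k)
  where open +-*-Solver

module Root {p : ℕ} (prime : Prime p) {g : ℤ} (root : PrimitiveRoot g p) where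

  open ModPrime prime public

  g⁻¹ : ℤ
  g⁻¹ = proj₁ (inverse g (proj₁ root))

  g*g⁻¹≈1 : g ℤ.* g⁻¹ ≈ 1ℤ
  g*g⁻¹≈1 = proj₂ (inverse g (proj₁ root))

  g^k*g⁻¹^k≈1 : ∀ k → g ℤ.^ k ℤ.* g⁻¹ ℤ.^ k ≈ 1ℤ
  g^k*g⁻¹^k≈1 = ^-*-inverse {g} {g⁻¹} g*g⁻¹≈1

  g^k≉0 : ∀ k → g ℤ.^ k ≉ 0ℤ
  g^k≉0 k = unit⇒≉0 {g ℤ.^ k} {g⁻¹ ℤ.^ k} (g^k*g⁻¹^k≈1 k)

  -- Otherwise all p − 1 units would be among the d powers g⁰, …, gᵈ⁻¹.
  g^d≉1 : ∀ d → 0 < d → d < p ∸ 1 → g ℤ.^ d ≉ 1ℤ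
  g^d≉1 d 0<d d<p-1 g^d≈1 = <⇒≱ d<p-1 (begin
    p ∸ 1
      ≡⟨ trans (∑-const [1⋯ p ∸ 1 ] 1) (trans (*-identityʳ _) (length-window 1 (p ∸ 1))) ⟨
    ∑ [1⋯ p ∸ 1 ] (λ _ → 1)
      ≤⟨ ∑-inject (λ r e → g ℤ.^ e ≈ + r) (window-unique 1 (p ∸ 1)) (λ {_} {_} {e} → inj {e = e}) tot ⟩
    ∑ (upTo d) (λ _ → 1)         ≡⟨ trans (∑-const (upTo d) 1) (trans (*-identityʳ _) (length-upTo d)) ⟩
    d                            ∎)
    where
    open ≤-Reasoning
    instance _ = >-nonZero 0<d

    <p : ∀ {r} → r ∈ [1⋯ p ∸ 1 ] → 0 < r × r < p
    <p {r} r∈ with 1≤r , r< ← ∈-window⁻ {1} r∈ = 1≤r , subst (r <_) (suc-pred p) r<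

    inj : ∀ {r r′ e} → r ∈ [1⋯ p ∸ 1 ] → r′ ∈ [1⋯ p ∸ 1 ] → g ℤ.^ e ≈ + r → g ℤ.^ e ≈ + r′ → r ≡ r′
    inj r∈ r′∈ er er′ = <p-≈⇒≡ (proj₂ (<p r∈)) (proj₂ (<p r′∈)) (≈-trans (≈-sym er) er′)

    reduce : ∀ k → g ℤ.^ k ≈ g ℤ.^ (k % d)
    reduce k = ≈-trans (≈-reflexive (trans (cong (g ℤ.^_) (m≡m%n+[m/n]*n k d))
        (trans (ℤ.^-distribˡ-+-* g (k % d) _)
        (cong (g ℤ.^ (k % d) ℤ.*_) (trans (cong (g ℤ.^_) (*-comm (k div d) d)) (sym (ℤ.^-*-assoc g d (k div d))))))))
      (≈-trans (*-congˡ (g ℤ.^ (k % d)) (≈-trans (^-cong (k div d) g^d≈1) (≈-reflexive (ℤ.^-zeroˡ (k div d)))))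
        (≈-reflexive (ℤ.*-identityʳ _)))

    tot : ∀ {r} → r ∈ [1⋯ p ∸ 1 ] → ∃[ e ] e ∈ upTo d × g ℤ.^ e ≈ + r × 1 ≤ 1
    tot {r} r∈ with 0<r , r<p ← <p r∈
      with k , e ← proj₂ root (+ r) (Coprime.sym (prime⇒coprime prime {{>-nonZero 0<r}} r<p)) =
      k % d , ∈-upTo⁺ (m%n<n k d) , ≈-trans (≈-sym (reduce k)) (mk e) , ≤-refl

  private
    -- Cancelling gⁱ leaves g^(j - i) ≡ 1 with j - i < p - 1, which `g^d≉1` excludes unless j = i.
    ^-injective≤ : ∀ {i j} → i ≤ j → j < i + (p ∸ 1) → g ℤ.^ i ≈ g ℤ.^ j → i ≡ j
    ^-injective≤ {i} {j} i≤j j< e with j ∸ i in eq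
    ... | zero  = ≤-antisym i≤j (m∸n≡0⇒m≤n eq)
    ... | suc d = ⊥-elim (g^d≉1 (suc d) z<s
      (+-cancelˡ-< i _ _ (subst (_< i + (p ∸ 1)) (sym i+d) j<))
      (*-cancelˡ (g ℤ.^ i) (g^k≉0 i)
        (≈-trans (≈-reflexive (trans (sym (ℤ.^-distribˡ-+-* g i (suc d))) (cong (g ℤ.^_) i+d)))
          (≈-trans (≈-sym e) (≈-reflexive (sym (ℤ.*-identityʳ _)))))))
      where
      i+d : i + suc d ≡ j
      i+d = trans (cong (λ d → i + d) (sym eq)) (m+[n∸m]≡n i≤j)

  ^-injective : ∀ {c k i j} → k ≤ p ∸ 1 → i ∈ window c k → j ∈ window c k →
                g ℤ.^ i ≈ g ℤ.^ j → i ≡ j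
  ^-injective {c} {k} {i} {j} k≤ i∈ j∈ e with ∈-window⁻ {c} i∈ | ∈-window⁻ {c} j∈ | ≤-total i j
  ... | c≤i , _ | _ , j< | inj₁ i≤j = ^-injective≤ i≤j (<-≤-trans j< (+-mono-≤ c≤i k≤)) e
  ... | _ , i< | c≤j , _ | inj₂ j≤i = sym (^-injective≤ j≤i (<-≤-trans i< (+-mono-≤ c≤j k≤)) (≈-sym e))

  ∑window≤1 : ∀ c {k} a → k ≤ p ∸ 1 → ∑ (window c k) (λ b → ⟦ g ℤ.^ a ≈? g ℤ.^ b ⟧) ≤ 1
  ∑window≤1 c {k} a k≤ = ∑⟦⟧≤1 (λ b → g ℤ.^ a ≈? g ℤ.^ b) (window-unique c k)
    λ b∈ b′∈ e e′ → ^-injective {c} k≤ b∈ b′∈ (≈-trans (≈-sym e) e′)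

  R² : List (ℤ × ℤ)
  R² = cartesianProduct residues residues

  R²-unique : Unique R²
  R²-unique = Unique.cartesianProduct⁺ residues-unique residues-unique

  length-R² : length R² ≡ p * p
  length-R² = trans (length-cartesianProduct residues residues) (cong₂ _*_ length-residues length-residues)

  R²-≈⇒≡ : ∀ {X Y X′ Y′} → (X , Y) ∈ R² → (X′ , Y′) ∈ R² → X ≈ X′ → Y ≈ Y′ → (X , Y) ≡ (X′ , Y′)
  R²-≈⇒≡ P∈ P′∈ eX eY with X∈ , Y∈ ← ∈-cartesianProduct⁻ residues residues P∈
    | X′∈ , Y′∈ ← ∈-cartesianProduct⁻ residues residues P′∈ =
    cong₂ _,_ (residue-≈⇒≡ X∈ X′∈ eX) (residue-≈⇒≡ Y∈ Y′∈ eY)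

  -- Incidences between lines and points of the plane modulo p

  module Lines {h : ℤ} (h≉0 : h ≉ 0ℤ) where

    OnLine : ℕ × ℕ → ℤ × ℤ → Set
    OnLine (a , b) (X , Y) = g ℤ.^ a ℤ.* X ℤ.- g ℤ.^ b ℤ.* Y ≈ h

    onLine? : ∀ u P → Dec (OnLine u P)
    onLine? (a , b) (X , Y) = (g ℤ.^ a ℤ.* X ℤ.- g ℤ.^ b ℤ.* Y) ≈? h

    -- For each `Y` the equation is solved by X ≡ g⁻ᵃ (h + gᵇ Y), and the resulting points are told
    -- apart by their second coordinate.
    p≤line : ∀ u → p ≤ ∑ R² (λ P → ⟦ onLine? u P ⟧)
    p≤line u@(a , b) = begin
      p                            ≡⟨ trans (∑-const residues 1) (trans (*-identityʳ _) length-residues) ⟨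
      ∑ residues (λ _ → 1)         ≤⟨ ∑-inject (λ Y P → Y ≡ proj₂ P) residues-unique
                                        (λ _ _ e e′ → trans e (sym e′)) tot ⟩
      ∑ R² (λ P → ⟦ onLine? u P ⟧) ∎
      where
      open ≤-Reasoning
      tot : ∀ {Y} → Y ∈ residues → ∃[ P ] P ∈ R² × Y ≡ proj₂ P × 1 ≤ ⟦ onLine? u P ⟧
      tot {Y} Y∈ =
        let X , X∈ , e = representative (g⁻¹ ℤ.^ a ℤ.* (h ℤ.+ g ℤ.^ b ℤ.* Y)) in
        (X , Y) , ∈-cartesianProduct⁺ X∈ Y∈ , refl ,
        1≤⟦⟧ (onLine? u (X , Y)) (solve (g ℤ.^ a) (g⁻¹ ℤ.^ a) (g ℤ.^ b ℤ.* Y) X (g^k*g⁻¹^k≈1 a) e)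
        where
        eq₁ : ∀ G G⁻¹ h y → G ℤ.* (G⁻¹ ℤ.* (h ℤ.+ y)) ℤ.- y ≡ G ℤ.* G⁻¹ ℤ.* (h ℤ.+ y) ℤ.- y
        eq₁ = solve-∀
        eq₂ : ∀ h y → 1ℤ ℤ.* (h ℤ.+ y) ℤ.- y ≡ h
        eq₂ = solve-∀
        solve : ∀ G G⁻¹ y X → G ℤ.* G⁻¹ ≈ 1ℤ → G⁻¹ ℤ.* (h ℤ.+ y) ≈ X → G ℤ.* X ℤ.- y ≈ h
        solve G G⁻¹ y X inv e =
          ≈-trans (sub-cong (*-congˡ G (≈-sym e)) (≈-refl {y}))
          (≈-trans (≈-reflexive (eq₁ G G⁻¹ h y))
          (≈-trans (sub-cong (*-cong inv (≈-refl {h ℤ.+ y})) (≈-refl {y}))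
            (≈-reflexive (eq₂ h y))))

    -- For each `X` the line determines gᵇ Y, hence `Y`, because gᵇ is invertible.
    line≤p : ∀ u → ∑ R² (λ P → ⟦ onLine? u P ⟧) ≤ p
    line≤p u@(a , b) = begin
      ∑ R² (λ P → ⟦ onLine? u P ⟧)
        ≡⟨ ∑-cartesianProduct residues residues _ ⟩
      ∑ residues (λ X → ∑ residues (λ Y → ⟦ onLine? u (X , Y) ⟧))
        ≤⟨ ∑-mono residues (λ X _ → ∑⟦⟧≤1 (λ Y → onLine? u (X , Y)) residues-unique (one X)) ⟩
      ∑ residues (λ _ → 1)  ≡⟨ trans (∑-const residues 1) (trans (*-identityʳ _) length-residues) ⟩
      p                     ∎
      where
      open ≤-Reasoning
      one : ∀ X {Y Y′} → Y ∈ residues → Y′ ∈ residues → OnLine u (X , Y) → OnLine u (X , Y′) → Y ≡ Y′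
      one X {Y} {Y′} Y∈ Y′∈ e e′ = residue-≈⇒≡ Y∈ Y′∈ (*-cancelˡ (g ℤ.^ b) (g^k≉0 b)
        (≈-trans (≈-reflexive (eq (g ℤ.^ a ℤ.* X) (g ℤ.^ b ℤ.* Y)))
        (≈-trans (sub-cong (≈-refl {g ℤ.^ a ℤ.* X}) (≈-trans e (≈-sym e′)))
          (≈-reflexive (sym (eq (g ℤ.^ a ℤ.* X) (g ℤ.^ b ℤ.* Y′)))))))
        where
        eq : ∀ x y → y ≡ x ℤ.- (x ℤ.- y)
        eq = solve-∀

    -- Two distinct points common to both lines give GH′ ≡ HG′; since
    -- h ≢ 0, the lines then coincide.
    two-points : ∀ G H G′ H′ X Y X′ Y′ → G ≉ 0ℤ → H ≉ 0ℤ →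
      G ℤ.* X ℤ.- H ℤ.* Y ≈ h → G′ ℤ.* X ℤ.- H′ ℤ.* Y ≈ h →
      G ℤ.* X′ ℤ.- H ℤ.* Y′ ≈ h → G′ ℤ.* X′ ℤ.- H′ ℤ.* Y′ ≈ h →
      (X ≈ X′ × Y ≈ Y′) ⊎ (G ≈ G′ × H ≈ H′)
    two-points G H G′ H′ X Y X′ Y′ G≉0 H≉0 e₁ e₂ e₃ e₄ =
      [ (λ Gx≈0 → inj₁ (fromx (integral′ G≉0 Gx≈0))) , fromdet ]′ (integral (G ℤ.* x) (G ℤ.* H′ ℤ.- H ℤ.* G′) det)
      where
      x y : ℤ
      x = X ℤ.- X′
      y = Y ℤ.- Y′

      diff≈0 : ∀ {a b} → a ≈ b → a ℤ.- b ≈ 0ℤ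
      diff≈0 {a} {b} e = ≈-trans (sub-cong e (≈-refl {b})) (≈-reflexive (ℤ.+-inverseʳ b))

      diff≈0⁻ : ∀ {a b} → a ℤ.- b ≈ 0ℤ → a ≈ b
      diff≈0⁻ {a} {b} (mk d) = via (ℤ.+-identityʳ (a ℤ.- b)) d

      integral′ : ∀ {a b} → a ≉ 0ℤ → a ℤ.* b ≈ 0ℤ → b ≈ 0ℤ
      integral′ {a} {b} a≉0 e = *-cancelˡ a a≉0 (≈-trans e (≈-reflexive (sym (ℤ.*-zeroʳ a))))

      subtract : ∀ G H → G ℤ.* X ℤ.- H ℤ.* Y ≈ h → G ℤ.* X′ ℤ.- H ℤ.* Y′ ≈ h → G ℤ.* x ℤ.- H ℤ.* y ≈ 0ℤ
      subtract G H e e′ = ≈-trans (≈-reflexive (eq G H X Y X′ Y′)) (diff≈0 (≈-trans e (≈-sym e′)))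
        where
        eq : ∀ G H X Y X′ Y′ → G ℤ.* (X ℤ.- X′) ℤ.- H ℤ.* (Y ℤ.- Y′)
           ≡ (G ℤ.* X ℤ.- H ℤ.* Y) ℤ.- (G ℤ.* X′ ℤ.- H ℤ.* Y′)
        eq = solve-∀

      s₁ : G ℤ.* x ℤ.- H ℤ.* y ≈ 0ℤ
      s₁ = subtract G H e₁ e₃
      s₂ : G′ ℤ.* x ℤ.- H′ ℤ.* y ≈ 0ℤ
      s₂ = subtract G′ H′ e₂ e₄

      -- Elimination of `y`: G H′ times `s₁` minus G H times `s₂`. Either x ≡ 0, and the points
      -- agree, or the determinant G H′ - H G′ vanishes.
      det : G ℤ.* x ℤ.* (G ℤ.* H′ ℤ.- H ℤ.* G′) ≈ 0ℤ
      det = ≈-trans (≈-reflexive (eq G H G′ H′ x y))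
        (≈-trans (sub-cong (*-congˡ (G ℤ.* H′) s₁) (*-congˡ (G ℤ.* H) s₂))
          (≈-reflexive (eq′ (G ℤ.* H′) (G ℤ.* H))))
        where
        eq : ∀ G H G′ H′ x y → G ℤ.* x ℤ.* (G ℤ.* H′ ℤ.- H ℤ.* G′)
           ≡ G ℤ.* H′ ℤ.* (G ℤ.* x ℤ.- H ℤ.* y) ℤ.- G ℤ.* H ℤ.* (G′ ℤ.* x ℤ.- H′ ℤ.* y)
        eq = solve-∀
        eq′ : ∀ a b → a ℤ.* 0ℤ ℤ.- b ℤ.* 0ℤ ≡ 0ℤ
        eq′ = solve-∀

      fromx : x ≈ 0ℤ → X ≈ X′ × Y ≈ Y′
      fromx x≈0 = diff≈0⁻ x≈0 , diff≈0⁻ (integral′ H≉0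
        (≈-trans (≈-reflexive (eq (G ℤ.* x) (H ℤ.* y))) (≈-trans (sub-cong (*-congˡ G x≈0) s₁)
          (≈-reflexive (eq′ G)))))
        where
        eq : ∀ a b → b ≡ a ℤ.- (a ℤ.- b)
        eq = solve-∀
        eq′ : ∀ a → a ℤ.* 0ℤ ℤ.- 0ℤ ≡ 0ℤ
        eq′ = solve-∀

      fromdet : G ℤ.* H′ ℤ.- H ℤ.* G′ ≈ 0ℤ → (X ≈ X′ × Y ≈ Y′) ⊎ (G ≈ G′ × H ≈ H′)
      fromdet d≈0 = inj₂ (cancel (ℤ.- Y) (hG G H G′ H′ X Y) e₁ e₂ d≈0 , cancel (ℤ.- X) (hH G H G′ H′ X Y) e₁ e₂ d≈0)
        where
        -- `M` and `M′` are the two linear forms at (X, Y), and M′ A - M A′ is the multiple k d of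
        -- the determinant d. Since M ≡ M′ ≡ h, this gives h A ≡ h A′, and h ≢ 0 is cancelled.
        cancel : ∀ {A A′ M M′ d} k →
          h ℤ.* A ℤ.- h ℤ.* A′ ≡ (h ℤ.- M′) ℤ.* A ℤ.- (h ℤ.- M) ℤ.* A′ ℤ.+ k ℤ.* d →
          M ≈ h → M′ ≈ h → d ≈ 0ℤ → A ≈ A′
        cancel {A} {A′} {M} {M′} {d} k eq e e′ d≈0 = *-cancelˡ h h≉0 (diff≈0⁻
          (≈-trans (≈-reflexive eq)
          (≈-trans (+-cong (sub-cong (*-cong (diff≈0 (≈-sym e′)) (≈-refl {A})) (*-cong (diff≈0 (≈-sym e)) (≈-refl {A′})))
            (*-congˡ k d≈0)) (≈-reflexive (zeros A A′ k)))))
          where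
          zeros : ∀ A A′ k → 0ℤ ℤ.* A ℤ.- 0ℤ ℤ.* A′ ℤ.+ k ℤ.* 0ℤ ≡ 0ℤ
          zeros = solve-∀
        hG : ∀ G H G′ H′ X Y → h ℤ.* G ℤ.- h ℤ.* G′ ≡ (h ℤ.- (G′ ℤ.* X ℤ.- H′ ℤ.* Y)) ℤ.* G
             ℤ.- (h ℤ.- (G ℤ.* X ℤ.- H ℤ.* Y)) ℤ.* G′ ℤ.+ (ℤ.- Y) ℤ.* (G ℤ.* H′ ℤ.- H ℤ.* G′)
        hG = lemma h
          where
          lemma : ∀ h G H G′ H′ X Y → h ℤ.* G ℤ.- h ℤ.* G′ ≡ (h ℤ.- (G′ ℤ.* X ℤ.- H′ ℤ.* Y)) ℤ.* G
             ℤ.- (h ℤ.- (G ℤ.* X ℤ.- H ℤ.* Y)) ℤ.* G′ ℤ.+ (ℤ.- Y) ℤ.* (G ℤ.* H′ ℤ.- H ℤ.* G′)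
          lemma = solve-∀
        hH : ∀ G H G′ H′ X Y → h ℤ.* H ℤ.- h ℤ.* H′ ≡ (h ℤ.- (G′ ℤ.* X ℤ.- H′ ℤ.* Y)) ℤ.* H
             ℤ.- (h ℤ.- (G ℤ.* X ℤ.- H ℤ.* Y)) ℤ.* H′ ℤ.+ (ℤ.- X) ℤ.* (G ℤ.* H′ ℤ.- H ℤ.* G′)
        hH = lemma h
          where
          lemma : ∀ h G H G′ H′ X Y → h ℤ.* H ℤ.- h ℤ.* H′ ≡ (h ℤ.- (G′ ℤ.* X ℤ.- H′ ℤ.* Y)) ℤ.* H
             ℤ.- (h ℤ.- (G ℤ.* X ℤ.- H ℤ.* Y)) ℤ.* H′ ℤ.+ (ℤ.- X) ℤ.* (G ℤ.* H′ ℤ.- H ℤ.* G′)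
          lemma = solve-∀

    -- Indicator that both lines have the same coefficients modulo p. As a product of indicators its
    -- sum over `A²` factors.
    same : ℕ × ℕ → ℕ × ℕ → ℕ
    same (a , b) (a′ , b′) = ⟦ g ℤ.^ a ≈? g ℤ.^ a′ ⟧ * ⟦ g ℤ.^ b ≈? g ℤ.^ b′ ⟧

    -- Lines with different coefficients share at most one point by `two-points`; otherwise the
    -- whole line, of at most p points, is counted. In this additive form the 1 gives the main term
    -- of the second moment and the coincidences give the error.
    lines-meet : ∀ u v → ∑ R² (λ P → ⟦ onLine? u P ⟧ * ⟦ onLine? v P ⟧) ≤ 1 + p * same u v
    lines-meet u@(a , b) v@(a′ , b′) = begin
      ∑ R² (λ P → ⟦ onLine? u P ⟧ * ⟦ onLine? v P ⟧)  ≡⟨ ∑-cong R² (λ P → ⟦⟧-× (onLine? u P) (onLine? v P)) ⟩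
      ∑ R² (λ P → ⟦ onLine? u P ×-dec onLine? v P ⟧)  ≤⟨ cases same? ⟩
      1 + p * ⟦ same? ⟧   ≡⟨ cong (λ s → 1 + p * s) (⟦⟧-× (g ℤ.^ a ≈? g ℤ.^ a′) (g ℤ.^ b ≈? g ℤ.^ b′)) ⟨
      1 + p * same u v  ∎
      where
      open ≤-Reasoning
      same? : Dec (g ℤ.^ a ≈ g ℤ.^ a′ × g ℤ.^ b ≈ g ℤ.^ b′)
      same? = (g ℤ.^ a ≈? g ℤ.^ a′) ×-dec (g ℤ.^ b ≈? g ℤ.^ b′)

      cases : (d : Dec (g ℤ.^ a ≈ g ℤ.^ a′ × g ℤ.^ b ≈ g ℤ.^ b′)) →
              ∑ R² (λ P → ⟦ onLine? u P ×-dec onLine? v P ⟧) ≤ 1 + p * ⟦ d ⟧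
      cases (yes _) = begin
        ∑ R² (λ P → ⟦ onLine? u P ×-dec onLine? v P ⟧)
          ≤⟨ ∑-mono R² (λ P _ → ⟦⟧-mono (onLine? u P ×-dec onLine? v P) (onLine? u P) proj₁) ⟩
        ∑ R² (λ P → ⟦ onLine? u P ⟧)  ≤⟨ line≤p u ⟩
        p                             ≡⟨ *-identityʳ p ⟨
        p * 1                         ≤⟨ n≤1+n _ ⟩
        1 + p * 1                     ∎
      cases (no ¬same) = ≤-trans
        (∑⟦⟧≤1 (λ P → onLine? u P ×-dec onLine? v P) R²-unique λ P∈ P′∈ (e₁ , e₂) (e₃ , e₄) →
          [ (λ (eX , eY) → R²-≈⇒≡ P∈ P′∈ eX eY) , (λ s → ⊥-elim (¬same s)) ]′
          (two-points (g ℤ.^ a) (g ℤ.^ b) (g ℤ.^ a′) (g ℤ.^ b′) _ _ _ _ (g^k≉0 a) (g^k≉0 b) e₁ e₂ e₃ e₄))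
        (m≤m+n 1 _)

    -- Second moment of the number of lines through a point

    module Variance (A : List ℕ) (thin : ∀ a → ∑ A (λ b → ⟦ g ℤ.^ a ≈? g ℤ.^ b ⟧) ≤ 2) where

      A² : List (ℕ × ℕ)
      A² = cartesianProduct A A

      F : ℤ × ℤ → ℕ
      F P = ∑ A² (λ u → ⟦ onLine? u P ⟧)

      private
        K : ℕ
        K = length A²

      open ≤-Reasoning

      -- A lower bound suffices, because `F` enters the variance linearly only in the negative cross
      -- term.
      ∑F : p * K ≤ ∑ R² F
      ∑F = begin
        p * K                                        ≡⟨ *-comm p K ⟩
        K * p                                        ≡⟨ ∑-const A² p ⟨
        ∑ A² (λ _ → p)                               ≤⟨ ∑-mono A² (λ u _ → p≤line u) ⟩
        ∑ A² (λ u → ∑ R² (λ P → ⟦ onLine? u P ⟧))    ≡⟨ ∑-swap A² R² _ ⟩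
        ∑ R² F                                       ∎

      -- The sum is a product over the two coordinates, and `thin` bounds each factor by 2.
      ∑same≤4 : ∀ u → ∑ A² (same u) ≤ 4
      ∑same≤4 (a , b) = begin
        ∑ A² (same (a , b))  ≡⟨ ∑²-* A A (λ a′ → ⟦ g ℤ.^ a ≈? g ℤ.^ a′ ⟧) (λ b′ → ⟦ g ℤ.^ b ≈? g ℤ.^ b′ ⟧) ⟩
        ∑ A (λ a′ → ⟦ g ℤ.^ a ≈? g ℤ.^ a′ ⟧) * ∑ A (λ b′ → ⟦ g ℤ.^ b ≈? g ℤ.^ b′ ⟧)
                             ≤⟨ *-mono-≤ (thin a) (thin b) ⟩
        4                    ∎

      -- The square F(P)² counts pairs of lines through P; after the sums are swapped, each pair of
      -- lines contributes its common points.
      ∑F² : ∑ R² (λ P → F P * F P) ≤ K * (K + p * 4)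
      ∑F² = begin
        ∑ R² (λ P → F P * F P)
          ≡⟨ ∑-cong R² (λ P → ∑*∑ A² A² (λ u → ⟦ onLine? u P ⟧) (λ v → ⟦ onLine? v P ⟧)) ⟩
        ∑ R² (λ P → ∑ A² (λ u → ∑ A² (λ v → meet u v P)))
          ≡⟨ ∑-swap R² A² _ ⟩
        ∑ A² (λ u → ∑ R² (λ P → ∑ A² (λ v → meet u v P)))
          ≡⟨ ∑-cong A² (λ u → ∑-swap R² A² _) ⟩
        ∑ A² (λ u → ∑ A² (λ v → ∑ R² (meet u v)))
          ≤⟨ ∑-mono A² (λ u _ → ∑-mono A² (λ v _ → lines-meet u v)) ⟩
        ∑ A² (λ u → ∑ A² (λ v → 1 + p * same u v))
          ≡⟨ ∑-cong A² (λ u → trans (∑-+ A² (λ _ → 1) _) (cong₂ _+_ (trans (∑-const A² 1) (*-identityʳ K)) (∑-*ˡ A² p (same u)))) ⟩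
        ∑ A² (λ u → K + p * ∑ A² (same u))
          ≤⟨ ∑-mono A² (λ u _ → +-monoʳ-≤ K (*-monoʳ-≤ p (∑same≤4 u))) ⟩
        ∑ A² (λ u → K + p * 4)
          ≡⟨ ∑-const A² _ ⟩
        K * (K + p * 4) ∎
        where
        meet : ℕ × ℕ → ℕ × ℕ → ℤ × ℤ → ℕ
        meet u v P = ⟦ onLine? u P ⟧ * ⟦ onLine? v P ⟧

      -- The cross term 2 p K ∑ F is at least 2 p² K² by `∑F`. This cancels the K² of the p² points
      -- together with the leading part K² of `∑F²`, and only the coincidences 4 p³ K remain.
      variance : ∑ R² (λ P → ∣ p * F P - K ∣ * ∣ p * F P - K ∣) ≤ 4 * (p * p * p) * K
      variance = +-cancelʳ-≤ (2 * p * K * (p * K)) _ _ (begin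
        S + 2 * p * K * (p * K)
          ≤⟨ +-monoʳ-≤ S (*-monoʳ-≤ (2 * p * K) ∑F) ⟩
        S + 2 * p * K * ∑ R² F
          ≡⟨ cong (_+_ S) (∑-*ˡ R² (2 * p * K) F) ⟨
        S + ∑ R² (λ P → 2 * p * K * F P)
          ≡⟨ ∑-+ R² _ _ ⟨
        ∑ R² (λ P → ∣ p * F P - K ∣ * ∣ p * F P - K ∣ + 2 * p * K * F P)
          ≡⟨ ∑-cong R² (λ P → expand (F P)) ⟩
        ∑ R² (λ P → p * p * (F P * F P) + K * K)
          ≡⟨ ∑-+ R² _ _ ⟩
        ∑ R² (λ P → p * p * (F P * F P)) + ∑ R² (λ _ → K * K)
          ≡⟨ cong₂ _+_ (∑-*ˡ R² (p * p) _) (trans (∑-const R² _) (cong (_* (K * K)) length-R²)) ⟩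
        p * p * ∑ R² (λ P → F P * F P) + p * p * (K * K)
          ≤⟨ +-monoˡ-≤ _ (*-monoʳ-≤ (p * p) ∑F²) ⟩
        p * p * (K * (K + p * 4)) + p * p * (K * K)
          ≡⟨ solve 2 (λ p K → p :* p :* (K :* (K :+ p :* con 4)) :+ p :* p :* (K :* K)
              := con 4 :* (p :* p :* p) :* K :+ con 2 :* p :* K :* (p :* K)) refl p K ⟩
        4 * (p * p * p) * K + 2 * p * K * (p * K) ∎)
        where
        open +-*-Solver
        S : ℕ
        S = ∑ R² (λ P → ∣ p * F P - K ∣ * ∣ p * F P - K ∣)
        expand : ∀ f → ∣ p * f - K ∣ * ∣ p * f - K ∣ + 2 * p * K * f ≡ p * p * (f * f) + K * K
        expand f = trans (cong (_+_ (∣ p * f - K ∣ * ∣ p * f - K ∣))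
            (solve 3 (λ p K f → con 2 :* p :* K :* f := con 2 :* (p :* f) :* K) refl p K f))
          (trans (∣m-n∣²+2mn≡m²+n² (p * f) K)
            (solve 3 (λ p K f → p :* f :* (p :* f) :+ K :* K := p :* p :* (f :* f) :+ K :* K) refl p K f))

    open ≤-Reasoning

    -- Sampling the second moment at points (bⁱ, bʲ)

    module _ (A : List ℕ) (thin : ∀ a → ∑ A (λ b → ⟦ g ℤ.^ a ≈? g ℤ.^ b ⟧) ≤ 2) where
      open Variance A thin

      -- The M² points (bⁱ, bʲ) are distinct and each contributes at least D² to the variance.
      deviation : ∀ {b M D} → (∀ {i j} → i < M → j < M → b ℤ.^ i ≈ b ℤ.^ j → i ≡ j) →
        (∀ {i j X Y} → i < M → j < M → b ℤ.^ i ≈ X → b ℤ.^ j ≈ Y →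
          D ≤ ∣ p * F (X , Y) - length A² ∣) →
        M * M * (D * D) ≤ 4 * (p * p * p) * (length A * length A)
      deviation {b} {M} {D} b-inj D≤ = begin
        M * M * (D * D)
          ≡⟨ cong (_* (D * D)) (trans (length-cartesianProduct (upTo M) (upTo M)) (cong₂ _*_ (length-upTo M) (length-upTo M))) ⟨
        length M² * (D * D)            ≡⟨ ∑-const M² (D * D) ⟨
        ∑ M² (λ _ → D * D)
          ≤⟨ ∑-inject Near (Unique.cartesianProduct⁺ (Unique.upTo⁺ M) (Unique.upTo⁺ M)) near-inj tot ⟩
        ∑ R² (λ P → ∣ p * F P - length A² ∣ * ∣ p * F P - length A² ∣)  ≤⟨ variance ⟩
        4 * (p * p * p) * length A²    ≡⟨ cong (4 * (p * p * p) *_) (length-cartesianProduct A A) ⟩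
        4 * (p * p * p) * (length A * length A) ∎
        where
        M² : List (ℕ × ℕ)
        M² = cartesianProduct (upTo M) (upTo M)

        <M : ∀ {i j} → (i , j) ∈ M² → i < M × j < M
        <M ij∈ = let i∈ , j∈ = ∈-cartesianProduct⁻ (upTo M) (upTo M) ij∈ in ∈-upTo⁻ i∈ , ∈-upTo⁻ j∈

        Near : ℕ × ℕ → ℤ × ℤ → Set
        Near (i , j) (X , Y) = b ℤ.^ i ≈ X × b ℤ.^ j ≈ Y

        near-inj : ∀ {s t P} → s ∈ M² → t ∈ M² → Near s P → Near t P → s ≡ t
        near-inj {i , j} {i′ , j′} {X , Y} s∈ t∈ (eX , eY) (eX′ , eY′) with i< , j< ← <M s∈ | i′< , j′< ← <M t∈ =
          cong₂ _,_ (b-inj i< i′< (≈-trans eX (≈-sym eX′))) (b-inj j< j′< (≈-trans eY (≈-sym eY′)))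

        tot : ∀ {s} → s ∈ M² → ∃[ P ] P ∈ R² × Near s P × D * D ≤ ∣ p * F P - length A² ∣ * ∣ p * F P - length A² ∣
        tot {i , j} s∈ =
          let i< , j< = <M s∈
              X , X∈ , eX = representative (b ℤ.^ i)
              Y , Y∈ , eY = representative (b ℤ.^ j)
              D≤′ = D≤ i< j< eX eY in
          (X , Y) , ∈-cartesianProduct⁺ X∈ Y∈ , (eX , eY) , *-mono-≤ D≤′ D≤′

    -- Comparison of J₁ with incidence counts from above and below

    module _ (N : ℕ) where

      N² : List (ℕ × ℕ)
      N² = cartesianProduct [1⋯ N ] [1⋯ N ]

      J : ℕ
      J = J₁ p g N h

      J≡∑ : J ≡ ∑ N² (λ s → ⟦ isSolution? p g h s ⟧)
      J≡∑ = length-filter≡∑ (isSolution? p g h) N²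

      -- Equal inverses come from equal residues, so injectivity of i ↦ gⁱ carries over.
      g⁻¹^-injective : ∀ {M} → M ≤ p ∸ 1 → ∀ {i j} → i < M → j < M → g⁻¹ ℤ.^ i ≈ g⁻¹ ℤ.^ j → i ≡ j
      g⁻¹^-injective M≤ {i} {j} i< j< e = ^-injective {0} M≤ (∈-window⁺ z≤n i<) (∈-window⁺ z≤n j<)
        (invert (g ℤ.^ i) (g ℤ.^ j) (g⁻¹ ℤ.^ i) (g⁻¹ ℤ.^ j) (g^k*g⁻¹^k≈1 i) (g^k*g⁻¹^k≈1 j) e)
        where
        invert : ∀ a b a⁻¹ b⁻¹ → a ℤ.* a⁻¹ ≈ 1ℤ → b ℤ.* b⁻¹ ≈ 1ℤ → a⁻¹ ≈ b⁻¹ → a ≈ b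
        invert a b a⁻¹ b⁻¹ ea eb e = ≈-trans (≈-reflexive (sym (ℤ.*-identityʳ a)))
          (≈-trans (*-congˡ a (≈-sym (≈-trans (*-congˡ b e) eb)))
          (≈-trans (≈-reflexive (eq a b a⁻¹)) (≈-trans (*-congˡ b ea) (≈-reflexive (ℤ.*-identityʳ b)))))
          where
          eq : ∀ a b c → a ℤ.* (b ℤ.* c) ≡ b ℤ.* (a ℤ.* c)
          eq = solve-∀

      -- Each solution (x, y) gives the line (x + i, y + j) through (g⁻ⁱ, g⁻ʲ), so J ≤ F there.
      -- Truncated subtraction makes D zero, and the claim trivial, when p J does not exceed (M +
      -- N)².
      upper : ∀ {M} → M ≤ p ∸ 1 → N ≤ p ∸ 1 → let D = p * J ∸ (M + N) * (M + N) in
        M * M * (D * D) ≤ 4 * (p * p * p) * ((M + N) * (M + N))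
      upper {M} M≤ N≤ = subst (λ l → M * M * ((p * J ∸ l * l) * (p * J ∸ l * l)) ≤ 4 * (p * p * p) * (l * l))
        length-E (deviation E thin {g⁻¹} {M} (g⁻¹^-injective M≤) D≤)
        where
        -- The interval 1, ..., M + N is cut into two windows of length at most p - 1. Even if M + N
        -- exceeds p - 1, each residue then occurs at most once per window, which is the 2 in
        -- `thin`.
        E : List ℕ
        E = window 1 M ++ window (suc M) N

        length-E : length E ≡ M + N
        length-E = trans (length-++ (window 1 M)) (cong₂ _+_ (length-window 1 M) (length-window (suc M) N))

        thin : ∀ a → ∑ E (λ b → ⟦ g ℤ.^ a ≈? g ℤ.^ b ⟧) ≤ 2
        thin a = ≤-trans (≤-reflexive (∑-++ (window 1 M) _ _))
          (+-mono-≤ (∑window≤1 1 a M≤) (∑window≤1 (suc M) a N≤))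

        open Variance E thin

        ∈E : ∀ {x i} → x ∈ [1⋯ N ] → i < M → x + i ∈ E
        ∈E {x} {i} x∈ i<M with ∈-window⁻ {1} x∈ | x + i <? suc M
        ... | 1≤x , x≤N | yes x+i≤M = ∈-++⁺ˡ (∈-window⁺ (m≤n⇒m≤n+o i 1≤x) x+i≤M)
        ... | 1≤x , x≤N | no x+i≰M = ∈-++⁺ʳ (window 1 M) (∈-window⁺ (≮⇒≥ x+i≰M)
          (<-≤-trans (+-mono-< x≤N i<M) (≤-reflexive (cong suc (+-comm N M)))))

        J≤F : ∀ {i j X Y} → i < M → j < M → g⁻¹ ℤ.^ i ≈ X → g⁻¹ ℤ.^ j ≈ Y → J ≤ F (X , Y)
        J≤F {i} {j} {X} {Y} i<M j<M eX eY = ≤-trans (≤-reflexive J≡∑)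
          (∑-inject (λ (x , y) (a , b) → a ≡ x + i × b ≡ y + j)
            (Unique.cartesianProduct⁺ (window-unique 1 N) (window-unique 1 N))
            (λ {(x , y)} {(x′ , y′)} _ _ (ea , eb) (ea′ , eb′) → cong₂ _,_
              (+-cancelʳ-≡ i x x′ (trans (sym ea) ea′)) (+-cancelʳ-≡ j y y′ (trans (sym eb) eb′)))
            λ {(x , y)} xy∈ → let x∈ , y∈ = ∈-cartesianProduct⁻ [1⋯ N ] [1⋯ N ] xy∈ in
              (x + i , y + j) , ∈-cartesianProduct⁺ (∈E x∈ i<M) (∈E y∈ j<M) , (refl , refl) ,
              ⟦⟧-mono (isSolution? p g h (x , y)) (onLine? (x + i , y + j) (X , Y))
                λ sol → ≈-trans (sub-cong (back x i eX) (back y j eY)) (mk sol))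
          where
          back : ∀ x i {X} → g⁻¹ ℤ.^ i ≈ X → g ℤ.^ (x + i) ℤ.* X ≈ g ℤ.^ x
          back x i {X} e = ≈-trans (≈-reflexive (trans (cong (ℤ._* X) (ℤ.^-distribˡ-+-* g x i)) (ℤ.*-assoc (g ℤ.^ x) _ X)))
            (≈-trans (*-congˡ (g ℤ.^ x) (≈-trans (*-congˡ (g ℤ.^ i) (≈-sym e)) (g^k*g⁻¹^k≈1 i)))
              (≈-reflexive (ℤ.*-identityʳ (g ℤ.^ x))))

        D≤ : ∀ {i j X Y} → i < M → j < M → g⁻¹ ℤ.^ i ≈ X → g⁻¹ ℤ.^ j ≈ Y →
          p * J ∸ length E * length E ≤ ∣ p * F (X , Y) - length A² ∣
        D≤ i<M j<M eX eY = ≤-trans (∸-mono (*-monoʳ-≤ p (J≤F i<M j<M eX eY)) (≤-reflexive (length-cartesianProduct E E)))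
          (m∸n≤∣m-n∣ _ (length A²))

      -- A line (a, b) through (gⁱ, gʲ) gives the solution (a + i, b + j); exponents up to N - M
      -- leave room for the shift, so F ≤ J there.
      lower : ∀ {M} → M ≤ N → N ≤ p ∸ 1 → let D = (N ∸ M) * (N ∸ M) ∸ p * J in
        M * M * (D * D) ≤ 4 * (p * p * p) * ((N ∸ M) * (N ∸ M))
      lower {M} M≤N N≤ = subst (λ l → M * M * ((l * l ∸ p * J) * (l * l ∸ p * J)) ≤ 4 * (p * p * p) * (l * l))
        (length-window 1 (N ∸ M)) (deviation E thin {g} {M}
          (λ i< j< → ^-injective {0} (≤-trans M≤N N≤) (∈-window⁺ z≤n i<) (∈-window⁺ z≤n j<)) D≤)
        where
        E : List ℕ
        E = window 1 (N ∸ M)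

        thin : ∀ a → ∑ E (λ b → ⟦ g ℤ.^ a ≈? g ℤ.^ b ⟧) ≤ 2
        thin a = ≤-trans (∑window≤1 1 a (≤-trans (m∸n≤m N M) N≤)) (n≤1+n 1)

        open Variance E thin

        ∈N : ∀ {a i} → a ∈ E → i < M → a + i ∈ [1⋯ N ]
        ∈N {a} {i} a∈ i<M with 1≤a , a≤ ← ∈-window⁻ {1} a∈ = ∈-window⁺ {1} (m≤n⇒m≤n+o i 1≤a)
          (<-≤-trans (+-mono-< a≤ i<M) (s≤s (≤-reflexive (m∸n+n≡m M≤N))))

        F≤J : ∀ {i j X Y} → i < M → j < M → g ℤ.^ i ≈ X → g ℤ.^ j ≈ Y → F (X , Y) ≤ J
        F≤J {i} {j} {X} {Y} i<M j<M eX eY = ≤-trans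
          (∑-inject (λ (a , b) (x , y) → x ≡ a + i × y ≡ b + j)
            (Unique.cartesianProduct⁺ (window-unique 1 (N ∸ M)) (window-unique 1 (N ∸ M)))
            (λ {(a , b)} {(a′ , b′)} _ _ (ea , eb) (ea′ , eb′) → cong₂ _,_
              (+-cancelʳ-≡ i a a′ (trans (sym ea) ea′)) (+-cancelʳ-≡ j b b′ (trans (sym eb) eb′)))
            λ {(a , b)} ab∈ → let a∈ , b∈ = ∈-cartesianProduct⁻ E E ab∈ in
              (a + i , b + j) , ∈-cartesianProduct⁺ (∈N a∈ i<M) (∈N b∈ j<M) , (refl , refl) ,
              ⟦⟧-mono (onLine? (a , b) (X , Y)) (isSolution? p g h (a + i , b + j))
                λ on → divides (≈-trans (sub-cong (forth a i eX) (forth b j eY)) on))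
          (≤-reflexive (sym J≡∑))
          where
          forth : ∀ a i {X} → g ℤ.^ i ≈ X → g ℤ.^ (a + i) ≈ g ℤ.^ a ℤ.* X
          forth a i e = ≈-trans (≈-reflexive (ℤ.^-distribˡ-+-* g a i)) (*-congˡ (g ℤ.^ a) e)

        D≤ : ∀ {i j X Y} → i < M → j < M → g ℤ.^ i ≈ X → g ℤ.^ j ≈ Y →
          length E * length E ∸ p * J ≤ ∣ p * F (X , Y) - length A² ∣
        D≤ {X = X} {Y} i<M j<M eX eY = ≤-trans
          (∸-mono (≤-reflexive (sym (length-cartesianProduct E E))) (*-monoʳ-≤ p (F≤J i<M j<M eX eY)))
          (≤-trans (m∸n≤∣m-n∣ (length A²) _) (≤-reflexive (∣-∣-comm (length A²) (p * F (X , Y)))))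

      -- As M ≤ N, replacing (N + M)² or (N - M)² by N² costs at most 3 N M. The constant 16 is 4 ·
      -- 2², from M + N ≤ 2 N; the lower case, which has 4, is relaxed to it.
      discrepancy : ∀ {M} → M ≤ N → N ≤ p ∸ 1 → ∃[ D ] ∣ p * J - N * N ∣ ≤ D + 3 * N * M ×
        M * M * (D * D) ≤ 16 * (p * p * p) * (N * N)
      discrepancy {M} M≤N N≤ with ≤-total (p * J) (N * N)
      ... | inj₁ pJ≤N² = (N ∸ M) * (N ∸ M) ∸ p * J , (begin
          ∣ p * J - N * N ∣       ≡⟨ m≤n⇒∣m-n∣≡n∸m pJ≤N² ⟩
          N * N ∸ p * J           ≤⟨ m≤n+o⇒m∸n≤o (N * N) (p * J) (begin
            N * N                          ≤⟨ split ⟩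
            L * L + 3 * N * M              ≤⟨ +-monoˡ-≤ _ (m≤n+m∸n (L * L) (p * J)) ⟩
            p * J + (L * L ∸ p * J) + 3 * N * M  ≡⟨ +-assoc (p * J) _ _ ⟩
            p * J + (L * L ∸ p * J + 3 * N * M)  ∎) ⟩
          L * L ∸ p * J + 3 * N * M  ∎) ,
        ≤-trans (lower M≤N N≤) (*-mono-≤ (*-monoˡ-≤ (p * p * p) {4} {16} (m≤m+n 4 12)) (*-mono-≤ (m∸n≤m N M) (m∸n≤m N M)))
        where
        L : ℕ
        L = N ∸ M
        split : N * N ≤ L * L + 3 * N * M
        split = subst (λ n → n * n ≤ L * L + 3 * n * M) (m∸n+n≡m M≤N) (begin
          (L + M) * (L + M)  ≤⟨ m≤m+n _ (L * M + 2 * M * M) ⟩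
          (L + M) * (L + M) + (L * M + 2 * M * M)
            ≡⟨ solve 2 (λ L M → (L :+ M) :* (L :+ M) :+ (L :* M :+ con 2 :* M :* M)
              := L :* L :+ con 3 :* (L :+ M) :* M) refl L M ⟩
          L * L + 3 * (L + M) * M ∎)
          where open +-*-Solver
      ... | inj₂ N²≤pJ = p * J ∸ (M + N) * (M + N) , (begin
          ∣ p * J - N * N ∣       ≡⟨ m≤n⇒∣n-m∣≡n∸m N²≤pJ ⟩
          p * J ∸ N * N           ≤⟨ m≤n+o⇒m∸n≤o (p * J) (N * N) (begin
            p * J                                ≤⟨ m≤n+m∸n (p * J) K ⟩
            K + D                                ≤⟨ +-monoˡ-≤ D K≤ ⟩
            N * N + 3 * N * M + D
              ≡⟨ solve 3 (λ a b c → a :+ b :+ c := a :+ (c :+ b)) refl (N * N) (3 * N * M) D ⟩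
            N * N + (D + 3 * N * M)              ∎) ⟩
          D + 3 * N * M  ∎) ,
        ≤-trans (upper (≤-trans M≤N N≤) N≤) (begin
          4 * (p * p * p) * K
            ≤⟨ *-monoʳ-≤ (4 * (p * p * p)) (*-mono-≤ (+-monoˡ-≤ N M≤N) (+-monoˡ-≤ N M≤N)) ⟩
          4 * (p * p * p) * ((N + N) * (N + N))
            ≡⟨ solve 2 (λ p N → con 4 :* (p :* p :* p) :* ((N :+ N) :* (N :+ N))
              := con 16 :* (p :* p :* p) :* (N :* N)) refl p N ⟩
          16 * (p * p * p) * (N * N)   ∎)
        where
        open +-*-Solver
        K D : ℕ
        K = (M + N) * (M + N)
        D = p * J ∸ K
        K≤ : K ≤ N * N + 3 * N * M
        K≤ = begin
          (M + N) * (M + N)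
            ≡⟨ solve 2 (λ M N → (M :+ N) :* (M :+ N) := N :* N :+ (M :* M :+ con 2 :* N :* M)) refl M N ⟩
          N * N + (M * M + 2 * N * M)  ≤⟨ +-monoʳ-≤ (N * N) (+-monoˡ-≤ (2 * N * M) (*-monoˡ-≤ M M≤N)) ⟩
          N * N + (N * M + 2 * N * M)
            ≡⟨ cong (_+_ (N * N)) (solve 2 (λ N M → N :* M :+ con 2 :* N :* M := con 3 :* N :* M) refl N M) ⟩
          N * N + 3 * N * M ∎

discrepancy : ∀ {p} → Prime p → ∀ {g} → PrimitiveRoot g p → ∀ {h} → ¬ (h ≡ 0ℤ [mod p ]) →
  ∀ {M N} → M ≤ N → N < p →
  ∃[ D ] ∣ p * J₁ p g N h - N * N ∣ ≤ D + 3 * N * M × M * M * (D * D) ≤ 16 * (p * p * p) * (N * N)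
discrepancy pp root h≢0 {N = N} M≤N N<p =
  Root.Lines.discrepancy pp root (Root.≢⇒≉ pp root h≢0) N M≤N (<⇒≤pred N<p)

-- From natural to real numbers

-- M is N or about p^(3/4), whichever is smaller.
choose-M : ∀ p N → 1 ≤ p → 1 ≤ N → ∃[ M ] 1 ≤ M × M ≤ N × M * M * (M * M) ≤ p * p * p ×
  (M ≡ N ⊎ p * p * p ≤ 16 * (M * M * (M * M)))
choose-M p (suc zero) 1≤p _ = 1 , ≤-refl , ≤-refl , *-mono-≤ (*-mono-≤ 1≤p 1≤p) 1≤p , inj₁ refl
choose-M p N@(suc N′@(suc _)) 1≤p _ with N * N * (N * N) ≤? p * p * p | choose-M p N′ 1≤p (s≤s z≤n)
... | yes N⁴≤p³ | _ = N , s≤s z≤n , ≤-refl , N⁴≤p³ , inj₁ refl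
... | no N⁴≰p³ | M , 1≤M , M≤N′ , M⁴≤p³ , inj₂ p³≤ = M , 1≤M , m≤n⇒m≤1+n M≤N′ , M⁴≤p³ , inj₂ p³≤
-- The threshold lies between M = N - 1 and N. Since N ≤ 2 M, passing from N⁴ to M⁴ loses the factor
-- 2⁴ = 16.
... | no N⁴≰p³ | M , 1≤M , M≤N′ , M⁴≤p³ , inj₁ refl = M , 1≤M , n≤1+n M , M⁴≤p³ , inj₂ (begin
    p * p * p                                        ≤⟨ <⇒≤ (≰⇒> N⁴≰p³) ⟩
    suc M * suc M * (suc M * suc M)                  ≤⟨ *-mono-≤ (*-mono-≤ N≤2M N≤2M) (*-mono-≤ N≤2M N≤2M) ⟩
    (M + M) * (M + M) * ((M + M) * (M + M))
      ≡⟨ solve 1 (λ M → (M :+ M) :* (M :+ M) :* ((M :+ M) :* (M :+ M))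
                                                          := con 16 :* (M :* M :* (M :* M))) refl M ⟩
    16 * (M * M * (M * M))                           ∎)
  where
  open ≤-Reasoning
  open +-*-Solver
  N≤2M : suc M ≤ M + M
  N≤2M = +-monoˡ-≤ M 1≤M

ι : ℕ → ℚ
ι n = + n / 1

private
  -- The value of `ι` in reduced form: on it sums and products of rationals compute, whereas `ι` is
  -- given by a normalising division.
  nat : ℕ → ℚ
  nat n = mkℚ (+ n) 0 (Coprime.sym (1-coprimeTo n))

  ι≡nat : ∀ n → ι n ≡ nat n
  ι≡nat n = ℚ.↥p/↧p≡p (nat n)

ι-* : ∀ m n → ι (m * n) ≡ ι m ℚ.* ι n
ι-* m n = trans (cong (_/ 1) (ℤ.pos-* m n)) (sym (cong₂ ℚ._*_ (ι≡nat m) (ι≡nat n)))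

ι-+ : ∀ m n → ι (m + n) ≡ ι m ℚ.+ ι n
ι-+ m n = trans (cong (_/ 1) (trans (ℤ.pos-+ m n) (sym (cong₂ ℤ._+_ (ℤ.*-identityʳ (+ m)) (ℤ.*-identityʳ (+ n))))))
  (sym (cong₂ ℚ._+_ (ι≡nat m) (ι≡nat n)))

0≤ι : ∀ n → 0ℚ ℚ.≤ ι n
0≤ι n = ℚ.nonNegative⁻¹ (ι n) {{ℚ.normalize-nonNeg n 1}}

0<ι : ∀ n .{{_ : NonZero n}} → 0ℚ ℚ.< ι n
0<ι n = ℚ.positive⁻¹ (ι n) {{ℚ.normalize-pos n 1}}

ι-mono-≤ : ∀ {m n} → m ≤ n → ι m ℚ.≤ ι n
ι-mono-≤ {m} {n} m≤n with k , refl ← m≤n⇒∃[o]m+o≡n m≤n =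
  subst₂ ℚ._≤_ (ℚ.+-identityʳ (ι m)) (sym (ι-+ m k)) (ℚ.+-monoʳ-≤ (ι m) (0≤ι k))

-- Proved for unnormalised rationals, where it is a cross multiplication.
ι-*-/ : ∀ m n .{{_ : NonZero n}} → ι n ℚ.* (+ m / n) ≡ ι m
ι-*-/ m n@(suc n-1) = ℚ.toℚᵘ-injective (begin
  toℚᵘ (ι n ℚ.* (+ m / n))                        ≈⟨ ℚ.toℚᵘ-homo-* (ι n) (+ m / n) ⟩
  toℚᵘ (ι n) ℚᵘ.* toℚᵘ (+ m / n)
    ≈⟨ ℚᵘ.*-cong (ℚ.toℚᵘ-fromℚᵘ (mkℚᵘ (+ n) 0)) (ℚ.toℚᵘ-fromℚᵘ (mkℚᵘ (+ m) n-1)) ⟩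
  mkℚᵘ (+ n) 0 ℚᵘ.* mkℚᵘ (+ m) n-1
    ≈⟨ *≡* (trans (ℤ.*-identityʳ (+ n ℤ.* + m)) (trans (ℤ.*-comm (+ n) (+ m)) (cong (λ k → + m ℤ.* + k) (sym (*-identityˡ n))))) ⟩
  mkℚᵘ (+ m) 0                                    ≈⟨ ℚ.toℚᵘ-fromℚᵘ (mkℚᵘ (+ m) 0) ⟨
  toℚᵘ (ι m)                                      ∎)
  where open ℚᵘ.≃-Reasoning

-- Inequalities in ℚ with rational approximations to the roots of p

private variable
  a b c d : ℚ

*-monoˡ : 0ℚ ℚ.≤ c → a ℚ.≤ b → c ℚ.* a ℚ.≤ c ℚ.* b
*-monoˡ {c} 0≤c = ℚ.*-monoˡ-≤-nonNeg c {{ℚ.nonNegative 0≤c}}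

*-monoʳ : 0ℚ ℚ.≤ c → a ℚ.≤ b → a ℚ.* c ℚ.≤ b ℚ.* c
*-monoʳ {c} 0≤c = ℚ.*-monoʳ-≤-nonNeg c {{ℚ.nonNegative 0≤c}}

*-mono : 0ℚ ℚ.≤ a → 0ℚ ℚ.≤ c → a ℚ.≤ b → c ℚ.≤ d → a ℚ.* c ℚ.≤ b ℚ.* d
*-mono 0≤a 0≤c a≤b c≤d = ℚ.≤-trans (*-monoˡ 0≤a c≤d) (*-monoʳ (ℚ.≤-trans 0≤c c≤d) a≤b)

*-nonNeg : 0ℚ ℚ.≤ a → 0ℚ ℚ.≤ b → 0ℚ ℚ.≤ a ℚ.* b
*-nonNeg {a} {b} 0≤a 0≤b = subst (ℚ._≤ a ℚ.* b) (ℚ.*-zeroʳ a) (*-monoˡ 0≤a 0≤b)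

*-cancelʳ-pos : 0ℚ ℚ.< c → a ℚ.* c ℚ.≤ b ℚ.* c → a ℚ.≤ b
*-cancelʳ-pos {c} 0<c = ℚ.*-cancelʳ-≤-pos c {{ℚ.positive 0<c}}

*-cancelˡ-pos : 0ℚ ℚ.< c → c ℚ.* a ℚ.≤ c ℚ.* b → a ℚ.≤ b
*-cancelˡ-pos {c} 0<c = ℚ.*-cancelˡ-≤-pos c {{ℚ.positive 0<c}}

-- Replaces the extraction of square roots, which ℚ does not allow.
square-cancel-≤ : 0ℚ ℚ.≤ b → a ℚ.* a ℚ.≤ b ℚ.* b → a ℚ.≤ b
square-cancel-≤ {b} {a} 0≤b a²≤b² with a ℚ.≤? b
... | yes a≤b = a≤b
... | no a≰b = ⊥-elim (ℚ.<-irrefl refl (ℚ.<-≤-trans b²<a² a²≤b²))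
  where
  b<a : b ℚ.< a
  b<a = ℚ.≰⇒> a≰b
  b²<a² : b ℚ.* b ℚ.< a ℚ.* a
  b²<a² = ℚ.≤-<-trans (*-monoˡ 0≤b (ℚ.<⇒≤ b<a)) (ℚ.*-monoˡ-<-pos a {{ℚ.positive (ℚ.≤-<-trans 0≤b b<a)}} b<a)

-- Here `w` approximates p^(1/4) from below and `s` approximates p^(1/2) from above, while `v₁` and
-- `v₂` stand for rationals above N / p^(1/4) and p^(1/2).
module Estimate {p N M D w s v₁ v₂ : ℚ}
  (0<p : 0ℚ ℚ.< p) (0<N : 0ℚ ℚ.< N) (0<M : 0ℚ ℚ.< M) (0≤D : 0ℚ ℚ.≤ D)
  (0<w : 0ℚ ℚ.< w) (0<s : 0ℚ ℚ.< s) (s≤v₂ : s ℚ.≤ v₂)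
  (w⁴≤p : w ℚ.* w ℚ.* (w ℚ.* w) ℚ.≤ p) (p≤s² : p ℚ.≤ s ℚ.* s)
  (N≤2wv₁ : N ℚ.≤ ι 2 ℚ.* w ℚ.* v₁)
  (M⁴≤p³ : M ℚ.* M ℚ.* (M ℚ.* M) ℚ.≤ p ℚ.* p ℚ.* p)
  (M²D²≤ : M ℚ.* M ℚ.* (D ℚ.* D) ℚ.≤ ι 16 ℚ.* (p ℚ.* p ℚ.* p) ℚ.* (N ℚ.* N))
  where

  open ℚ.≤-Reasoning
  open ℚ-Solver

  private
    0≤p = ℚ.<⇒≤ 0<p
    0≤N = ℚ.<⇒≤ 0<N
    0≤M = ℚ.<⇒≤ 0<M
    0≤w = ℚ.<⇒≤ 0<w
    0≤s = ℚ.<⇒≤ 0<s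

    *-pos : 0ℚ ℚ.< a → 0ℚ ℚ.< b → 0ℚ ℚ.< a ℚ.* b
    *-pos {a} {b} 0<a 0<b = subst (ℚ._< a ℚ.* b) (ℚ.*-zeroʳ a) (ℚ.*-monoʳ-<-pos a {{ℚ.positive 0<a}} 0<b)

  -- M ≤ p^(3/4) and w ≤ p^(1/4), compared through fourth powers.
  Mw≤p : M ℚ.* w ℚ.≤ p
  Mw≤p = square-cancel-≤ 0≤p (square-cancel-≤ (*-nonNeg 0≤p 0≤p) (begin
    M ℚ.* w ℚ.* (M ℚ.* w) ℚ.* (M ℚ.* w ℚ.* (M ℚ.* w))
      ≡⟨ solve 2 (λ M w → M :* w :* (M :* w) :* (M :* w :* (M :* w))
           := M :* M :* (M :* M) :* (w :* w :* (w :* w))) refl M w ⟩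
    M ℚ.* M ℚ.* (M ℚ.* M) ℚ.* (w ℚ.* w ℚ.* (w ℚ.* w))
      ≤⟨ *-mono (*-nonNeg (*-nonNeg 0≤M 0≤M) (*-nonNeg 0≤M 0≤M)) (*-nonNeg (*-nonNeg 0≤w 0≤w) (*-nonNeg 0≤w 0≤w)) M⁴≤p³ w⁴≤p ⟩
    p ℚ.* p ℚ.* p ℚ.* p
      ≡⟨ ℚ.*-assoc (p ℚ.* p) p p ⟩
    p ℚ.* p ℚ.* (p ℚ.* p) ∎))

  NM≤ : ι 3 ℚ.* N ℚ.* M ℚ.≤ ι 6 ℚ.* p ℚ.* v₁
  NM≤ = *-cancelʳ-pos 0<w (begin
    ι 3 ℚ.* N ℚ.* M ℚ.* w            ≡⟨ ℚ.*-assoc (ι 3 ℚ.* N) M w ⟩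
    ι 3 ℚ.* N ℚ.* (M ℚ.* w)
      ≤⟨ *-mono (*-nonNeg (0≤ι 3) 0≤N) (*-nonNeg 0≤M 0≤w) (*-monoˡ (0≤ι 3) N≤2wv₁) Mw≤p ⟩
    ι 3 ℚ.* (ι 2 ℚ.* w ℚ.* v₁) ℚ.* p ≡⟨ solve 3 (λ w v p → con (ι 3) :* (con (ι 2) :* w :* v) :* p
                                          := con (ι 6) :* p :* v :* w) refl w v₁ p ⟩
    ι 6 ℚ.* p ℚ.* v₁ ℚ.* w           ∎)

  -- The factor N² cancels and leaves D² ≤ 16 p³ ≤ (4 p s)².
  M≡N⇒D≤ : M ≡ N → D ℚ.≤ ι 4 ℚ.* p ℚ.* v₂
  M≡N⇒D≤ refl = ℚ.≤-trans (square-cancel-≤ (*-nonNeg (*-nonNeg (0≤ι 4) 0≤p) 0≤s) (*-cancelˡ-pos (*-pos 0<N 0<N) (begin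
    N ℚ.* N ℚ.* (D ℚ.* D)                          ≤⟨ M²D²≤ ⟩
    ι 16 ℚ.* (p ℚ.* p ℚ.* p) ℚ.* (N ℚ.* N)
      ≤⟨ *-monoʳ (*-nonNeg 0≤N 0≤N) (*-monoˡ (0≤ι 16) (*-monoˡ (*-nonNeg 0≤p 0≤p) p≤s²)) ⟩
    ι 16 ℚ.* (p ℚ.* p ℚ.* (s ℚ.* s)) ℚ.* (N ℚ.* N)
      ≡⟨ solve 3 (λ p s N → con (ι 16) :* (p :* p :* (s :* s)) :* (N :* N)
        := N :* N :* (con (ι 4) :* p :* s :* (con (ι 4) :* p :* s))) refl p s N ⟩
    N ℚ.* N ℚ.* (ι 4 ℚ.* p ℚ.* s ℚ.* (ι 4 ℚ.* p ℚ.* s)) ∎)))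
    (*-monoˡ (*-nonNeg (0≤ι 4) 0≤p) s≤v₂)

  -- Now M is at least half of p^(3/4), so D ≤ 4 p^(3/2) N / M is at most 8 p^(3/4) N. Multiplied by
  -- w this is at most 8 p N, and N ≤ 2 w v₁ doubles the 8.
  p³≤⇒D≤ : p ℚ.* p ℚ.* p ℚ.≤ ι 16 ℚ.* (M ℚ.* M ℚ.* (M ℚ.* M)) → D ℚ.≤ ι 16 ℚ.* p ℚ.* v₁
  p³≤⇒D≤ p³≤ = *-cancelʳ-pos 0<w (begin
    D ℚ.* w                          ≤⟨ Dw≤ ⟩
    ι 8 ℚ.* p ℚ.* N                  ≤⟨ *-monoˡ (*-nonNeg (0≤ι 8) 0≤p) N≤2wv₁ ⟩
    ι 8 ℚ.* p ℚ.* (ι 2 ℚ.* w ℚ.* v₁) ≡⟨ solve 3 (λ w v p → con (ι 8) :* p :* (con (ι 2) :* w :* v)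
                                          := con (ι 16) :* p :* v :* w) refl w v₁ p ⟩
    ι 16 ℚ.* p ℚ.* v₁ ℚ.* w          ∎)
    where
    pw²≤4M² : p ℚ.* (w ℚ.* w) ℚ.≤ ι 4 ℚ.* (M ℚ.* M)
    pw²≤4M² = square-cancel-≤ (*-nonNeg (0≤ι 4) (*-nonNeg 0≤M 0≤M)) (begin
      p ℚ.* (w ℚ.* w) ℚ.* (p ℚ.* (w ℚ.* w))  ≡⟨ solve 2 (λ p w → p :* (w :* w) :* (p :* (w :* w))
          := p :* p :* (w :* w :* (w :* w))) refl p w ⟩
      p ℚ.* p ℚ.* (w ℚ.* w ℚ.* (w ℚ.* w))    ≤⟨ *-monoˡ (*-nonNeg 0≤p 0≤p) w⁴≤p ⟩
      p ℚ.* p ℚ.* p                          ≤⟨ p³≤ ⟩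
      ι 16 ℚ.* (M ℚ.* M ℚ.* (M ℚ.* M))       ≡⟨ solve 1 (λ M → con (ι 16) :* (M :* M :* (M :* M))
          := con (ι 4) :* (M :* M) :* (con (ι 4) :* (M :* M))) refl M ⟩
      ι 4 ℚ.* (M ℚ.* M) ℚ.* (ι 4 ℚ.* (M ℚ.* M)) ∎)

    Dw≤ : D ℚ.* w ℚ.≤ ι 8 ℚ.* p ℚ.* N
    Dw≤ = square-cancel-≤ (*-nonNeg (*-nonNeg (0≤ι 8) 0≤p) 0≤N) (*-cancelˡ-pos (*-pos 0<M 0<M) (begin
      M ℚ.* M ℚ.* (D ℚ.* w ℚ.* (D ℚ.* w))
        ≡⟨ solve 3 (λ M D w → M :* M :* (D :* w :* (D :* w)) := M :* M :* (D :* D) :* (w :* w)) refl M D w ⟩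
      M ℚ.* M ℚ.* (D ℚ.* D) ℚ.* (w ℚ.* w)
        ≤⟨ *-monoʳ (*-nonNeg 0≤w 0≤w) M²D²≤ ⟩
      ι 16 ℚ.* (p ℚ.* p ℚ.* p) ℚ.* (N ℚ.* N) ℚ.* (w ℚ.* w)
        ≡⟨ solve 3 (λ p N w → con (ι 16) :* (p :* p :* p) :* (N :* N) :* (w :* w)
             := con (ι 16) :* (p :* p) :* (N :* N) :* (p :* (w :* w))) refl p N w ⟩
      ι 16 ℚ.* (p ℚ.* p) ℚ.* (N ℚ.* N) ℚ.* (p ℚ.* (w ℚ.* w))
        ≤⟨ *-monoˡ (*-nonNeg (*-nonNeg (0≤ι 16) (*-nonNeg 0≤p 0≤p)) (*-nonNeg 0≤N 0≤N)) pw²≤4M² ⟩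
      ι 16 ℚ.* (p ℚ.* p) ℚ.* (N ℚ.* N) ℚ.* (ι 4 ℚ.* (M ℚ.* M))
        ≡⟨ solve 3 (λ p N M → con (ι 16) :* (p :* p) :* (N :* N) :* (con (ι 4) :* (M :* M))
             := M :* M :* (con (ι 8) :* p :* N :* (con (ι 8) :* p :* N))) refl p N M ⟩
      M ℚ.* M ℚ.* (ι 8 ℚ.* p ℚ.* N ℚ.* (ι 8 ℚ.* p ℚ.* N)) ∎))

  0≤v₁ : 0ℚ ℚ.≤ v₁
  0≤v₁ = *-cancelˡ-pos (*-pos (0<ι 2) 0<w) (ℚ.≤-trans (ℚ.≤-reflexive (ℚ.*-zeroʳ (ι 2 ℚ.* w))) (ℚ.≤-trans 0≤N N≤2wv₁))

  -- The constant 22 is 16 + 6, the coefficients of p v₁ in the bounds for D and for 3 N M; the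
  -- coefficient 4 of p v₂ is enlarged to match.
  estimate : M ≡ N ⊎ p ℚ.* p ℚ.* p ℚ.≤ ι 16 ℚ.* (M ℚ.* M ℚ.* (M ℚ.* M)) →
    D ℚ.+ ι 3 ℚ.* N ℚ.* M ℚ.≤ p ℚ.* (ι 22 ℚ.* (v₁ ℚ.+ v₂))
  estimate choice = begin
    D ℚ.+ ι 3 ℚ.* N ℚ.* M                                   ≤⟨ ℚ.+-mono-≤ D≤ NM≤ ⟩
    ι 16 ℚ.* p ℚ.* v₁ ℚ.+ ι 22 ℚ.* p ℚ.* v₂ ℚ.+ ι 6 ℚ.* p ℚ.* v₁  ≡⟨ solve 3 (λ p v₁ v₂ →
        con (ι 16) :* p :* v₁ :+ con (ι 22) :* p :* v₂ :+ con (ι 6) :* p :* v₁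
        := p :* (con (ι 22) :* (v₁ :+ v₂))) refl p v₁ v₂ ⟩
    p ℚ.* (ι 22 ℚ.* (v₁ ℚ.+ v₂))                            ∎
    where
    16pv₁ = ι 16 ℚ.* p ℚ.* v₁
    22pv₂ = ι 22 ℚ.* p ℚ.* v₂
    0≤v₂ : 0ℚ ℚ.≤ v₂
    0≤v₂ = ℚ.≤-trans 0≤s s≤v₂

    D≤ : D ℚ.≤ 16pv₁ ℚ.+ 22pv₂
    D≤ = [ (λ M≡N → ℚ.≤-trans (M≡N⇒D≤ M≡N) (begin
             ι 4 ℚ.* p ℚ.* v₂   ≤⟨ *-monoʳ 0≤v₂ (*-monoʳ 0≤p (ι-mono-≤ {4} {22} (m≤m+n 4 18))) ⟩
             22pv₂              ≡⟨ ℚ.+-identityˡ 22pv₂ ⟨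
             0ℚ ℚ.+ 22pv₂       ≤⟨ ℚ.+-monoˡ-≤ 22pv₂ (*-nonNeg (*-nonNeg (0≤ι 16) 0≤p) 0≤v₁) ⟩
             16pv₁ ℚ.+ 22pv₂    ∎))
         , (λ p³≤ → ℚ.≤-trans (p³≤⇒D≤ p³≤) (begin
             16pv₁              ≡⟨ ℚ.+-identityʳ 16pv₁ ⟨
             16pv₁ ℚ.+ 0ℚ       ≤⟨ ℚ.+-monoʳ-≤ 16pv₁ (*-nonNeg (*-nonNeg (0≤ι 22) 0≤p) 0≤v₂) ⟩
             16pv₁ ℚ.+ 22pv₂    ∎)) ]′ choice

-- From elements of the upper cuts to the rational estimates

fourth-root-witness : ∀ N p .{{_ : NonZero p}} {v} → ℝ≥0.Upper (fromℕ N /ᵣ (fromℕ p ^1/ 4)) v →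
  ∃[ w ] 0ℚ ℚ.< w × w ℚ.* w ℚ.* (w ℚ.* w) ℚ.≤ ι p × ι N ℚ.≤ ι 2 ℚ.* w ℚ.* v
fourth-root-witness N p {v} (a , i , N<a , (0<i , l , 0<l , l≤root , 1<li) , ai<v) =
  w , 0<w , subst (ℚ._≤ ι p) (solve 1 (λ w → w :* (w :* (w :* (w :* con 1ℚ))) := w :* w :* (w :* w)) refl w)
    (ℚ.≮⇒≥ λ p<w⁴ → l≤root (w , 0<w , w<l , p<w⁴)) , (begin
    ι N                   ≡⟨ ℚ.*-identityʳ (ι N) ⟨
    ι N ℚ.* 1ℚ            ≤⟨ *-mono (0≤ι N) (ℚ.nonNegative⁻¹ 1ℚ) (ℚ.<⇒≤ N<a) (ℚ.<⇒≤ 1<li) ⟩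
    a ℚ.* (l ℚ.* i)       ≡⟨ solve 3 (λ a l i → a :* (l :* i) := l :* (a :* i)) refl a l i ⟩
    l ℚ.* (a ℚ.* i)       ≤⟨ *-monoˡ (ℚ.<⇒≤ 0<l) (ℚ.<⇒≤ ai<v) ⟩
    l ℚ.* v               ≡⟨ solve 2 (λ l v → l :* v := con (ι 2) :* (con ½ :* l) :* v) refl l v ⟩
    ι 2 ℚ.* w ℚ.* v       ∎)
  where
  open ℚ.≤-Reasoning
  open ℚ-Solver
  -- `l≤root` says that no positive rational strictly below l has fourth power above p. Half of l is
  -- such a rational, so w⁴ ≤ p; the halving costs the factor 2 in N ≤ 2 w v.
  w : ℚ
  w = ½ ℚ.* l
  0<w : 0ℚ ℚ.< w
  0<w = subst (ℚ._< w) (ℚ.*-zeroʳ ½) (ℚ.*-monoʳ-<-pos ½ 0<l)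
  w<l : w ℚ.< l
  w<l = subst (w ℚ.<_) (ℚ.*-identityˡ l) (ℚ.*-monoˡ-<-pos l {{ℚ.positive 0<l}} {½} {1ℚ} (ℚ.*<* (ℤ.+<+ (s≤s (s≤s z≤n)))))

square-root-witness : ∀ p {v} → ℝ≥0.Upper (fromℕ p ^1/ 2) v →
  ∃[ s ] 0ℚ ℚ.< s × s ℚ.≤ v × ι p ℚ.≤ s ℚ.* s
square-root-witness p (s , 0<s , s<v , p<s²) =
  s , 0<s , ℚ.<⇒≤ s<v , ℚ.<⇒≤ (subst (ι p ℚ.<_) (cong (s ℚ.*_) (ℚ.*-identityʳ s)) p<s²)

ι-∸ : ∀ {m n k} → m ≤ n + k → ι m ℚ.- ι n ℚ.≤ ι k
ι-∸ {m} {n} {k} m≤n+k = begin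
  ι m ℚ.- ι n             ≤⟨ ℚ.+-monoˡ-≤ (ℚ.- ι n) (ι-mono-≤ m≤n+k) ⟩
  ι (n + k) ℚ.- ι n       ≡⟨ cong (ℚ._- ι n) (ι-+ n k) ⟩
  ι n ℚ.+ ι k ℚ.- ι n     ≡⟨ solve 2 (λ n k → n :+ k :- n := k) refl (ι n) (ι k) ⟩
  ι k                     ∎
  where
  open ℚ.≤-Reasoning
  open ℚ-Solver

-- Links the rational deviation to the distance in ℕ that `discrepancy` controls: p clears the
-- denominator, and both signs of x are covered by the same distance.
∣J-N²/p∣ : ∀ p .{{_ : NonZero p}} J N → ι p ℚ.* ℚ.∣ + J / 1 - + (N ^ 2) / p ∣ ℚ.≤ ι ∣ p * J - N * N ∣
∣J-N²/p∣ p J N = [ (λ eq → begin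
    ι p ℚ.* ℚ.∣ x ∣           ≡⟨ cong (ι p ℚ.*_) eq ⟩
    ι p ℚ.* x                 ≡⟨ px ⟩
    ι (p * J) ℚ.- ι (N * N)   ≤⟨ ι-∸ {n = N * N} (m≤n+∣m-n∣ (p * J) (N * N)) ⟩
    ι ∣ p * J - N * N ∣       ∎)
  , (λ eq → begin
    ι p ℚ.* ℚ.∣ x ∣           ≡⟨ cong (ι p ℚ.*_) eq ⟩
    ι p ℚ.* ℚ.- x             ≡⟨ ℚ.neg-distribʳ-* (ι p) x ⟨
    ℚ.- (ι p ℚ.* x)           ≡⟨ cong ℚ.-_ px ⟩
    ℚ.- (ι (p * J) ℚ.- ι (N * N))  ≡⟨ solve 2 (λ a b → :- (a :- b) := b :- a) refl (ι (p * J)) (ι (N * N)) ⟩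
    ι (N * N) ℚ.- ι (p * J)   ≤⟨ ι-∸ {n = p * J} (m≤n+∣n-m∣ (N * N) (p * J)) ⟩
    ι ∣ p * J - N * N ∣       ∎) ]′ (ℚ.∣p∣≡p∨∣p∣≡-p x)
  where
  open ℚ.≤-Reasoning
  open ℚ-Solver
  x : ℚ
  x = + J / 1 - + (N ^ 2) / p
  px : ι p ℚ.* x ≡ ι (p * J) ℚ.- ι (N * N)
  px = trans (solve 3 (λ p a b → p :* (a :- b) := p :* a :- p :* b) refl (ι p) (ι J) (+ (N ^ 2) / p))
    (cong₂ ℚ._-_ (sym (ι-* p J)) (trans (ι-*-/ (N ^ 2) p) (cong (λ k → ι (N * k)) (*-identityʳ N))))

-- M is chosen from p and N alone, w and s from the given cut elements; the inequality is proved
-- after multiplication by p.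
bound : ∀ {p} .{{_ : NonZero p}} → Prime p → ∀ {g} → PrimitiveRoot g p → ∀ {N} → 1 ≤ N → N < p →
  ∀ {h} → ¬ (h ≡ 0ℤ [mod p ]) → ∀ {v₁ v₂} →
  ℝ≥0.Upper (fromℕ N /ᵣ (fromℕ p ^1/ 4)) v₁ → ℝ≥0.Upper (fromℕ p ^1/ 2) v₂ →
  ℚ.∣ + J₁ p g N h / 1 - + (N ^ 2) / p ∣ ℚ.≤ ι 22 ℚ.* (v₁ ℚ.+ v₂)
bound {p} pp {g} root {N} 1≤N N<p {h} h≢0 {v₁} {v₂} V₁ V₂ =
  let w , 0<w , w⁴≤p , N≤2wv₁ = fourth-root-witness N p V₁
      s , 0<s , s≤v₂ , p≤s² = square-root-witness p V₂
      M , 1≤M , M≤N , M⁴≤p³ , choice = choose-M p N (>-nonZero⁻¹ p) 1≤N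
      D , diff≤ , M²D²≤ = discrepancy pp root {h} h≢0 M≤N N<p
      open Estimate (0<ι p) (0<ι N {{>-nonZero 1≤N}}) (0<ι M {{>-nonZero 1≤M}}) (0≤ι D) 0<w 0<s s≤v₂ w⁴≤p p≤s²
             N≤2wv₁ (subst₂ ℚ._≤_ (ι-fourth M) (ι-cube p) (ι-mono-≤ M⁴≤p³))
             (subst₂ ℚ._≤_ (ι-squares M D) (ι-product p N) (ι-mono-≤ M²D²≤))
  in *-cancelˡ-pos (0<ι p) (begin
    ι p ℚ.* ℚ.∣ + J₁ p g N h / 1 - + (N ^ 2) / p ∣  ≤⟨ ∣J-N²/p∣ p (J₁ p g N h) N ⟩
    ι ∣ p * J₁ p g N h - N * N ∣                    ≤⟨ ι-mono-≤ diff≤ ⟩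
    ι (D + 3 * N * M)
      ≡⟨ trans (ι-+ D _) (cong (ι D ℚ.+_) (trans (ι-* (3 * N) M) (cong (ℚ._* ι M) (ι-* 3 N)))) ⟩
    ι D ℚ.+ ι 3 ℚ.* ι N ℚ.* ι M                     ≤⟨ estimate ([ (λ M≡N → inj₁ (cong ι M≡N)) ,
        (λ p³≤ → inj₂ (subst₂ ℚ._≤_ (ι-cube p) (trans (ι-* 16 (M * M * (M * M))) (cong (ι 16 ℚ.*_) (ι-fourth M))) (ι-mono-≤ p³≤))) ]′ choice) ⟩
    ι p ℚ.* (ι 22 ℚ.* (v₁ ℚ.+ v₂))                  ∎)
  where
  open ℚ.≤-Reasoning
  ι-cube : ∀ a → ι (a * a * a) ≡ ι a ℚ.* ι a ℚ.* ι a
  ι-cube a = trans (ι-* (a * a) a) (cong (ℚ._* ι a) (ι-* a a))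
  ι-squares : ∀ a b → ι (a * a * (b * b)) ≡ ι a ℚ.* ι a ℚ.* (ι b ℚ.* ι b)
  ι-squares a b = trans (ι-* (a * a) (b * b)) (cong₂ ℚ._*_ (ι-* a a) (ι-* b b))
  ι-fourth : ∀ a → ι (a * a * (a * a)) ≡ ι a ℚ.* ι a ℚ.* (ι a ℚ.* ι a)
  ι-fourth a = ι-squares a a
  ι-product : ∀ a b → ι (16 * (a * a * a) * (b * b)) ≡ ι 16 ℚ.* (ι a ℚ.* ι a ℚ.* ι a) ℚ.* (ι b ℚ.* ι b)
  ι-product a b = trans (ι-* (16 * (a * a * a)) (b * b))
    (cong₂ ℚ._*_ (trans (ι-* 16 (a * a * a)) (cong (ι 16 ℚ.*_) (ι-cube a))) (ι-* b b))

theorem2 : Σ[ C ∈ ℝ≥0 ] Positive C ×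
    (∀ (p : ℕ) .{{_ : NonZero p}} → Prime p →
    ∀ (g : ℤ) → PrimitiveRoot g p →
    ∀ (N : ℕ) → 1 ≤ N → N < p →
    ∀ (h : ℤ) → ¬ (h ≡ 0ℤ [mod p ]) →
    ∣ + J₁ p g N h / 1 - + (N ^ 2) / p ∣ᵣ
    ≤ᵣ C *ᵣ (fromℕ N /ᵣ (fromℕ p ^1/ 4) +ᵣ fromℕ p ^1/ 2))
theorem2 = fromℕ 22 , fromℕ-pos {22} , λ p pp g root N 1≤N N<p h h≢0 → λ {
  (u , v , 22<u , (v₁ , v₂ , V₁ , V₂ , v₁+v₂<v) , uv<q) →
    -- A rational q above the right-hand side comes with u > 22 and v > v₁ + v₂ such that u v < q.
    -- The last inequality supplies the strictness that membership in the cut of a rational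
    -- requires.
    let 0<v₁+v₂ = ℚ.+-mono-< (ℝ≥0.pos (fromℕ N /ᵣ (fromℕ p ^1/ 4)) V₁) (ℝ≥0.pos (fromℕ p ^1/ 2) V₂) in
    ℚ.≤-<-trans (bound pp root 1≤N N<p h≢0 V₁ V₂)
      (ℚ.≤-<-trans (*-mono (0≤ι 22) (ℚ.<⇒≤ 0<v₁+v₂) (ℚ.<⇒≤ 22<u) (ℚ.<⇒≤ v₁+v₂<v)) uv<q) }
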